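{- For every real $\varepsilon > 0$ and every integer $k\geq 2$, there exist positive integers $C = C(\varepsilon, k)$ and $n_0 = n_0(\varepsilon, k)$ such that the following holds for all $n \geq n_0$. If $H$ is an $n$-vertex linear $k$-graph with $\delta(H) \geq \frac{n}{k} + C$, then $H$ contains a matching $M$ that covers at least $(1 - \varepsilon)n$ vertices.
   Context: A $k$-graph is a (simple, finite) hypergraph in which every edge has exactly $k$ vertices. A hypergraph is linear if every two distinct edges share at most one vertex. The degree of a vertex is the number of edges containing it, and $\delta(H)$ denotes the minimum degree of $H$. A matching is a set of pairwise vertex-disjoint edges; it covers the vertices contained in its edges. -}

module Defs where

open import Data.Fin.Base using (Fin)
open import Data.Fin.Subset using (Subset; ∣_∣; _∩_; ⋃; Empty)
open import Data.Fin.Subset.Properties using (_∈?_)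
open import Data.Integer.Base using (+_)
open import Data.List.Base using (List; length; map; filter; allFin)
open import Data.List.Extrema.Nat using (min)
open import Data.List.Membership.Propositional using (_∈_)
open import Data.List.Relation.Binary.Subset.Propositional using (_⊆_)
open import Data.List.Relation.Unary.All using (All)
open import Data.List.Relation.Unary.AllPairs using (AllPairs)
open import Data.List.Relation.Unary.Unique.Propositional using (Unique)
open import Data.Nat.Base as ℕ using (ℕ)
import Data.Nat.Properties as ℕₚ
open import Data.Product.Base using (_×_; _,_; ∃-syntax; Σ-syntax)
open import Data.Rational.Base as ℚ using (ℚ; 0ℚ; 1ℚ)
import Data.Rational.Properties as ℚₚ
open import Level using (0ℓ)
open import Relation.Binary.PropositionalEquality
open import Relation.Nullary.Decidable using (dec⇒maybe)
open import Tactic.RingSolver using (solve-∀)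
open import Tactic.RingSolver.Core.AlmostCommutativeRing
  using (AlmostCommutativeRing; fromCommutativeRing)

------------------------------------------------------------------------
-- Real numbers as Cauchy sequences of rationals.  Two sequences represent
-- the same real when each is ≤ℝ the other; no quotient is taken.

Cauchy : (ℕ → ℚ) → Set
Cauchy x = ∀ δ → 0ℚ ℚ.< δ →
  ∃[ N ] (∀ i j → N ℕ.≤ i → N ℕ.≤ j → ℚ.∣ x i ℚ.- x j ∣ ℚ.< δ)

record ℝ : Set where
  constructor mkℝ
  field
    seq    : ℕ → ℚ
    cauchy : Cauchy seq

open ℝ public

infix 4 _<ℝ_ _≤ℝ_

_<ℝ_ : ℝ → ℝ → Set
x <ℝ y = Σ[ δ ∈ ℚ ] (0ℚ ℚ.< δ ×
  ∃[ N ] (∀ i → N ℕ.≤ i → seq x i ℚ.+ δ ℚ.≤ seq y i))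

_≤ℝ_ : ℝ → ℝ → Set
x ≤ℝ y = ∀ δ → 0ℚ ℚ.< δ →
  ∃[ N ] (∀ i → N ℕ.≤ i → seq x i ℚ.≤ seq y i ℚ.+ δ)

private
  ℚ-ring : AlmostCommutativeRing 0ℓ 0ℓ
  ℚ-ring = fromCommutativeRing ℚₚ.+-*-commutativeRing (λ p → dec⇒maybe (0ℚ ℚₚ.≟ p))

  half : ∀ δ → 0ℚ ℚ.< δ → ∃[ η ] (0ℚ ℚ.< η × η ℚ.+ η ≡ δ)
  half δ 0<δ = ℚ.½ ℚ.* δ ,
    subst (ℚ._< ℚ.½ ℚ.* δ) (ℚₚ.*-zeroʳ ℚ.½) (ℚₚ.*-monoʳ-<-pos ℚ.½ 0<δ) ,
    (begin
      ℚ.½ ℚ.* δ ℚ.+ ℚ.½ ℚ.* δ ≡⟨ sym (ℚₚ.*-distribʳ-+ δ ℚ.½ ℚ.½) ⟩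
      1ℚ ℚ.* δ                ≡⟨ ℚₚ.*-identityˡ δ ⟩
      δ                       ∎)
    where open ≡-Reasoning

  sub-cauchy : ∀ {x y} → Cauchy x → Cauchy y → Cauchy (λ i → x i ℚ.- y i)
  sub-cauchy {x} {y} cx cy δ 0<δ =
    let η , 0<η , η+η≡δ = half δ 0<δ
        M , hM = cx η 0<η
        N , hN = cy η 0<η
    in M ℕ.⊔ N , λ i j i≥ j≥ → begin-strict
    ℚ.∣ (x i ℚ.- y i) ℚ.- (x j ℚ.- y j) ∣
      ≡⟨ cong ℚ.∣_∣ (rearrange (x i) (y i) (x j) (y j)) ⟩
    ℚ.∣ (x i ℚ.- x j) ℚ.- (y i ℚ.- y j) ∣
      ≤⟨ ℚₚ.∣p-q∣≤∣p∣+∣q∣ (x i ℚ.- x j) (y i ℚ.- y j) ⟩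
    ℚ.∣ x i ℚ.- x j ∣ ℚ.+ ℚ.∣ y i ℚ.- y j ∣
      <⟨ ℚₚ.+-mono-<
           (hM i j (ℕₚ.m⊔n≤o⇒m≤o M N i≥) (ℕₚ.m⊔n≤o⇒m≤o M N j≥))
           (hN i j (ℕₚ.m⊔n≤o⇒n≤o M N i≥) (ℕₚ.m⊔n≤o⇒n≤o M N j≥)) ⟩
    η ℚ.+ η
      ≡⟨ η+η≡δ ⟩
    δ ∎
    where
    open ℚₚ.≤-Reasoning
    rearrange : ∀ a b c d →
      (a ℚ.- b) ℚ.- (c ℚ.- d) ≡ (a ℚ.- c) ℚ.- (b ℚ.- d)
    rearrange = solve-∀ ℚ-ring

  eventuallyBounded : ∀ {x} → Cauchy x →
    ∃[ B ] (0ℚ ℚ.< B × ∃[ N ] (∀ i → N ℕ.≤ i → ℚ.∣ x i ∣ ℚ.≤ B))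
  eventuallyBounded {x} cx =
    let N , hN = cx 1ℚ (ℚₚ.positive⁻¹ 1ℚ) in
    1ℚ ℚ.+ ℚ.∣ x N ∣ ,
    ℚₚ.+-mono-<-≤ (ℚₚ.positive⁻¹ 1ℚ) (ℚₚ.0≤∣p∣ (x N)) ,
    N , λ i i≥ → begin
      ℚ.∣ x i ∣                           ≡⟨ cong ℚ.∣_∣ (split (x i) (x N)) ⟩
      ℚ.∣ (x i ℚ.- x N) ℚ.+ x N ∣         ≤⟨ ℚₚ.∣p+q∣≤∣p∣+∣q∣ (x i ℚ.- x N) (x N) ⟩
      ℚ.∣ x i ℚ.- x N ∣ ℚ.+ ℚ.∣ x N ∣     ≤⟨ ℚₚ.+-monoˡ-≤ ℚ.∣ x N ∣ (ℚₚ.<⇒≤ (hN i N i≥ ℕₚ.≤-refl)) ⟩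
      1ℚ ℚ.+ ℚ.∣ x N ∣                    ∎
    where
    open ℚₚ.≤-Reasoning
    split : ∀ a b → a ≡ (a ℚ.- b) ℚ.+ b
    split = solve-∀ ℚ-ring

  divide : ∀ δ D → 0ℚ ℚ.< δ → 0ℚ ℚ.< D → ∃[ η ] (0ℚ ℚ.< η × D ℚ.* η ≡ δ)
  divide δ D 0<δ 0<D = D⁻¹ ℚ.* δ ,
    subst (ℚ._< D⁻¹ ℚ.* δ) (ℚₚ.*-zeroʳ D⁻¹) (ℚₚ.*-monoʳ-<-pos D⁻¹ {{ℚₚ.1/pos⇒pos D}} 0<δ) ,
    (begin
      D ℚ.* (D⁻¹ ℚ.* δ) ≡⟨ sym (ℚₚ.*-assoc D D⁻¹ δ) ⟩
      (D ℚ.* D⁻¹) ℚ.* δ ≡⟨ cong (ℚ._* δ) (ℚₚ.*-inverseʳ D) ⟩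
      1ℚ ℚ.* δ          ≡⟨ ℚₚ.*-identityˡ δ ⟩
      δ                 ∎)
    where
    open ≡-Reasoning
    instance
      D-pos : ℚ.Positive D
      D-pos = ℚ.positive 0<D
      D-nonZero : ℚ.NonZero D
      D-nonZero = ℚₚ.pos⇒nonZero D
    D⁻¹ : ℚ
    D⁻¹ = ℚ.1/ D

  product-< : ∀ {a b B η} → 0ℚ ℚ.< B → ℚ.∣ a ∣ ℚ.≤ B → ℚ.∣ b ∣ ℚ.< η →
    ℚ.∣ a ℚ.* b ∣ ℚ.< B ℚ.* η
  product-< {a} {b} {B} {η} 0<B a≤B b<η = begin-strict
    ℚ.∣ a ℚ.* b ∣       ≡⟨ ℚₚ.∣p*q∣≡∣p∣*∣q∣ a b ⟩
    ℚ.∣ a ∣ ℚ.* ℚ.∣ b ∣ ≤⟨ ℚₚ.*-monoʳ-≤-nonNeg ℚ.∣ b ∣ {{ℚₚ.∣-∣-nonNeg b}} a≤B ⟩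
    B ℚ.* ℚ.∣ b ∣       <⟨ ℚₚ.*-monoʳ-<-pos B {{ℚ.positive 0<B}} b<η ⟩
    B ℚ.* η             ∎
    where open ℚₚ.≤-Reasoning

  mul-cauchy : ∀ {x y} → Cauchy x → Cauchy y → Cauchy (λ i → x i ℚ.* y i)
  mul-cauchy {x} {y} cx cy δ 0<δ =
    let A , 0<A , K , hK = eventuallyBounded cx
        B , 0<B , L , hL = eventuallyBounded cy
        η , 0<η , D*η≡δ = divide δ (A ℚ.+ B) 0<δ (ℚₚ.+-mono-< 0<A 0<B)
        M , hM = cx η 0<η
        N , hN = cy η 0<η
    in (K ℕ.⊔ L) ℕ.⊔ (M ℕ.⊔ N) , λ i j i≥ j≥ →
    let i≥KL = ℕₚ.m⊔n≤o⇒m≤o (K ℕ.⊔ L) (M ℕ.⊔ N) i≥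
        j≥KL = ℕₚ.m⊔n≤o⇒m≤o (K ℕ.⊔ L) (M ℕ.⊔ N) j≥
        i≥MN = ℕₚ.m⊔n≤o⇒n≤o (K ℕ.⊔ L) (M ℕ.⊔ N) i≥
        j≥MN = ℕₚ.m⊔n≤o⇒n≤o (K ℕ.⊔ L) (M ℕ.⊔ N) j≥
    in begin-strict
    ℚ.∣ x i ℚ.* y i ℚ.- x j ℚ.* y j ∣
      ≡⟨ cong ℚ.∣_∣ (rearrange (x i) (y i) (x j) (y j)) ⟩
    ℚ.∣ x i ℚ.* (y i ℚ.- y j) ℚ.+ y j ℚ.* (x i ℚ.- x j) ∣
      ≤⟨ ℚₚ.∣p+q∣≤∣p∣+∣q∣ (x i ℚ.* (y i ℚ.- y j)) (y j ℚ.* (x i ℚ.- x j)) ⟩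
    ℚ.∣ x i ℚ.* (y i ℚ.- y j) ∣ ℚ.+ ℚ.∣ y j ℚ.* (x i ℚ.- x j) ∣
      <⟨ ℚₚ.+-mono-<
           (product-< {x i} 0<A (hK i (ℕₚ.m⊔n≤o⇒m≤o K L i≥KL))
             (hN i j (ℕₚ.m⊔n≤o⇒n≤o M N i≥MN) (ℕₚ.m⊔n≤o⇒n≤o M N j≥MN)))
           (product-< {y j} 0<B (hL j (ℕₚ.m⊔n≤o⇒n≤o K L j≥KL))
             (hM i j (ℕₚ.m⊔n≤o⇒m≤o M N i≥MN) (ℕₚ.m⊔n≤o⇒m≤o M N j≥MN))) ⟩
    A ℚ.* η ℚ.+ B ℚ.* η
      ≡⟨ sym (ℚₚ.*-distribʳ-+ η A B) ⟩
    (A ℚ.+ B) ℚ.* η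
      ≡⟨ D*η≡δ ⟩
    δ ∎
    where
    open ℚₚ.≤-Reasoning
    rearrange : ∀ a b c d →
      a ℚ.* b ℚ.- c ℚ.* d ≡ a ℚ.* (b ℚ.- d) ℚ.+ d ℚ.* (a ℚ.- c)
    rearrange = solve-∀ ℚ-ring

  constant-cauchy : ∀ q → Cauchy (λ _ → q)
  constant-cauchy q δ 0<δ = 0 , λ _ _ _ _ →
    subst (λ r → ℚ.∣ r ∣ ℚ.< δ) (sym (ℚₚ.+-inverseʳ q)) 0<δ

infixl 6 _-ℝ_
infixl 7 _*ℝ_

_-ℝ_ : ℝ → ℝ → ℝ
x -ℝ y = mkℝ (λ i → seq x i ℚ.- seq y i) (sub-cauchy {seq x} {seq y} (cauchy x) (cauchy y))

_*ℝ_ : ℝ → ℝ → ℝ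
x *ℝ y = mkℝ (λ i → seq x i ℚ.* seq y i) (mul-cauchy {seq x} {seq y} (cauchy x) (cauchy y))

ℕ→ℚ : ℕ → ℚ
ℕ→ℚ m = (+ m) ℚ./ 1

ℕ→ℝ : ℕ → ℝ
ℕ→ℝ m = mkℝ (λ _ → ℕ→ℚ m) (constant-cauchy (ℕ→ℚ m))

------------------------------------------------------------------------
-- Hypergraphs on the vertex set Fin n.  The edge set is a duplicate-free
-- list, so there are no repeated edges.

record Hypergraph (n : ℕ) : Set where
  field
    edges        : List (Subset n)
    edges-unique : Unique edges

open Hypergraph public

Uniform : ∀ {n} → ℕ → Hypergraph n → Set
Uniform k H = All (λ e → ∣ e ∣ ≡ k) (edges H)

Linear : ∀ {n} → Hypergraph n → Set
Linear H = ∀ {e f} → e ∈ edges H → f ∈ edges H → e ≢ f → ∣ e ∩ f ∣ ℕ.≤ 1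

degree : ∀ {n} → Hypergraph n → Fin n → ℕ
degree H v = length (filter (v ∈?_) (edges H))

-- The first argument of min is the value on the empty list. No degree exceeds
-- the number of edges, so for n ≥ 1 this is the true minimum of the degrees.
minDegree : ∀ {n} → Hypergraph n → ℕ
minDegree {n} H = min (length (edges H)) (map (degree H) (allFin n))

record Matching {n : ℕ} (H : Hypergraph n) : Set where
  field
    members  : List (Subset n)
    unique   : Unique members
    included : members ⊆ edges H
    disjoint : AllPairs (λ e f → Empty (e ∩ f)) members

covered : ∀ {n} {H : Hypergraph n} → Matching H → Subset n
covered M = ⋃ (Matching.members M)

{-# OPTIONS --safe #-}

-- Fix D large in terms of ε and k, and choose a set G of edges minimising
-- Φ(G) = Σ_v r_v² with r_v = D - d_G(v), locally under adding or deleting one edge.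
-- Then Σ_{u∈e} r_u ≤ k/2 for e ∉ G and Σ_{u∈e} r_u ≥ -k/2 for e ∈ G.  Let v maximise r.
-- If r_v > 0, at least n/k edges at v lie outside G, because the degree of v is at
-- least n/k + D; summing the first inequality over them gives Σ r_u ≤ n/2.  (This is
-- LP duality for fractional perfect matchings.)  Summing the second one over G bounds
-- Σ r_u d_G(u) from below; together Φ(G) ≤ D n, which is small compared with D² n.
--
-- The matching is built greedily in G.  With m vertices left, let p be the degree the
-- remaining vertices should have (p = D at the start, then p ↦ p (1 - k(k-1)/m)) and
-- V = Σ (d_v - p)² over them.  Averaged over the edges that may be taken next, linearity
-- shows that V grows by at most a factor 1 + B/m plus O(D), with B depending only on
-- ε and k as long as m ≥ ε n; so some edge does at most that.  Hence V = O(D n)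
-- throughout, which for large D is smaller than p² m / 4 and forces edges to remain.

module Submission where

-- The target degree never recovers: while m ≥ n / g it can fall to D / Γ, with Γ = g ^ (2 k²). So V
-- has to be kept linear in D, to be beaten by p² of order D² / Γ². This dictates two estimates. The
-- additive noise of one step must be O(D) rather than O(D²); it is, because in a linear system
-- taking an edge costs any other vertex at most k edges. The relative growth of V is governed by
-- the ratio of the maximum degree of G to p, so the local minimum must also supply deg ≤ 2 k D, a
-- bound that deletions preserve; the ratio D / p ≤ Γ then gives B = 8 k² Γ, free of D. Hence the
-- constants can be fixed without circularity, in the order `K₁`, Γ, `K`, `D`, `n₀`. No probability
-- or division occurs: p is a fraction P / q, deviations are multiplied by q, averages by the number
-- of edges, and each step multiplies q by m. All estimates are thus polynomial inequalities over
-- the integers.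

-- Finite sums of integers, indicators and averaging.

module IntegerSums where

  open import Data.Bool.Base using (Bool; true; false)
  open import Data.Fin.Base using (Fin; zero; suc)
  open import Data.Fin.Properties using (suc-injective; any?)
  open import Data.Integer.Base renaming (suc to sucℤ)
  open import Data.Integer.Properties
  open import Data.Integer.Tactic.RingSolver using (solve-∀)
  open import Data.Nat.Base as ℕ using (ℕ; zero; suc)
  open import Data.Product.Base using (_×_; _,_; ∃-syntax)
  open import Data.Empty using (⊥-elim)
  open import Function.Base using (_∘_)
  open import Relation.Binary.PropositionalEquality
  open import Relation.Nullary.Decidable using (yes; no; _×-dec_)
  import Data.Bool.Properties as 𝔹ₚ
  open import Algebra.Properties.Semiring.Sum +-*-semiring
    using (sum; ∑-distrib-+; ∑-comm; *-distribˡ-sum; sum-cong-≗)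

  -- The standard way to prove a polynomial inequality below: `s` is an explicit certificate,
  -- assembled with `⊕` and `⊛` from known nonnegative pieces, and the equation is left to the ring
  -- solver (the local lemmas called `expand`).
  ≤-from-difference : ∀ {i j} s → 0ℤ ≤ s → j ≡ i + s → i ≤ j
  ≤-from-difference {i} s 0≤s refl =
    subst (_≤ i + s) (+-identityʳ i) (+-monoʳ-≤ i 0≤s)

  0≤difference : ∀ {i j} → i ≤ j → 0ℤ ≤ j - i
  0≤difference = i≤j⇒0≤j-i

  infixl 6 _⊕_
  infixl 7 _⊛_

  _⊕_ : ∀ {i j} → 0ℤ ≤ i → 0ℤ ≤ j → 0ℤ ≤ i + j
  _⊕_ = +-mono-≤

  _⊛_ : ∀ {i j} → 0ℤ ≤ i → 0ℤ ≤ j → 0ℤ ≤ i * j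
  _⊛_ {i} {j} 0≤i 0≤j =
    subst (_≤ i * j) (*-zeroʳ i) (*-monoˡ-≤-nonNeg i {{nonNegative 0≤i}} 0≤j)

  0≤square : ∀ i → 0ℤ ≤ i * i
  0≤square (+ n)    = +≤+ (ℕ.z≤n {n}) ⊛ +≤+ (ℕ.z≤n {n})
  0≤square -[1+ n ] = +≤+ ℕ.z≤n

  0≤+ : ∀ {n} → 0ℤ ≤ + n
  0≤+ = +≤+ ℕ.z≤n

  0<* : ∀ {i j} → 0ℤ < i → 0ℤ < j → 0ℤ < i * j
  0<* {i} {j} 0<i 0<j =
    subst (_< i * j) (*-zeroʳ i) (*-monoˡ-<-pos i {{positive 0<i}} 0<j)

  *-cancelˡ-≤-positive : ∀ {c i j} → 0ℤ < c → c * i ≤ c * j → i ≤ j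
  *-cancelˡ-≤-positive {c} {i} {j} 0<c = *-cancelˡ-≤-pos i j c {{positive 0<c}}

  -- Opaque, so that unification can recover the summand from a sum.
  opaque
    ∑ : ∀ {n} → (Fin n → ℤ) → ℤ
    ∑ = sum

    ∑-empty : (f : Fin 0 → ℤ) → ∑ f ≡ 0ℤ
    ∑-empty f = refl

    ∑-step : ∀ {n} (f : Fin (suc n) → ℤ) → ∑ f ≡ f zero + ∑ (f ∘ suc)
    ∑-step f = refl

    ∑-cong : ∀ {n} {f g : Fin n → ℤ} → (∀ i → f i ≡ g i) → ∑ f ≡ ∑ g
    ∑-cong = sum-cong-≗

    ∑-swap : ∀ {m n} (f : Fin m → Fin n → ℤ) →
      ∑ (λ i → ∑ λ j → f i j) ≡ ∑ (λ j → ∑ λ i → f i j)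
    ∑-swap = ∑-comm

    ∑-* : ∀ {n} c (f : Fin n → ℤ) → ∑ (λ i → c * f i) ≡ c * ∑ f
    ∑-* c f = sym (*-distribˡ-sum c f)

    ∑-+ : ∀ {n} (f g : Fin n → ℤ) → ∑ (λ i → f i + g i) ≡ ∑ f + ∑ g
    ∑-+ = ∑-distrib-+

    ∑-mono : ∀ {n} {f g : Fin n → ℤ} → (∀ i → f i ≤ g i) → ∑ f ≤ ∑ g
    ∑-mono {zero}  f≤g = ≤-refl
    ∑-mono {suc n} f≤g = +-mono-≤ (f≤g zero) (∑-mono (f≤g ∘ suc))

    ∑-zero : ∀ n → ∑ {n} (λ _ → 0ℤ) ≡ 0ℤ
    ∑-zero zero    = refl
    ∑-zero (suc n) = trans (+-identityˡ _) (∑-zero n)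

    ∑-one : ∀ n → ∑ {n} (λ _ → 1ℤ) ≡ + n
    ∑-one zero    = refl
    ∑-one (suc n) = cong (_+_ 1ℤ) (∑-one n)

    -- Putting the exceptional terms on the opposite sides cancels them, which avoids sums over an
    -- index set with `v` removed.
    ∑-mono-except : ∀ {n} {f g : Fin n → ℤ} v →
      (∀ u → u ≢ v → f u ≤ g u) → ∑ f + g v ≤ ∑ g + f v
    ∑-mono-except {suc n} {f} {g} zero f≤g =
      ≤-from-difference _ (0≤difference (∑-mono (λ u → f≤g (suc u) λ ())))
        (regroup (f zero) (sum (f ∘ suc)) (g zero) (sum (g ∘ suc)))
      where
      regroup : ∀ a s b t → (b + t) + a ≡ ((a + s) + b) + (t - s)
      regroup = solve-∀
    ∑-mono-except {suc n} {f} {g} (suc v) f≤g =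
      ≤-from-difference _
        (0≤difference (f≤g zero λ ()) ⊕ 0≤difference
          (∑-mono-except v λ u u≢v → f≤g (suc u) (u≢v ∘ suc-injective)))
        (regroup (f zero) (sum (f ∘ suc)) (f (suc v)) (g zero) (sum (g ∘ suc)) (g (suc v)))
      where
      regroup : ∀ a s x b t y →
        (b + t) + x ≡ ((a + s) + y) + ((b - a) + ((t + x) - (s + y)))
      regroup = solve-∀

  0≤∑ : ∀ {n} {f : Fin n → ℤ} → (∀ i → 0ℤ ≤ f i) → 0ℤ ≤ ∑ f
  0≤∑ {n} {f} 0≤f = subst (_≤ ∑ f) (∑-zero n) (∑-mono 0≤f)

  ∑-linear : ∀ {n} a b (f g : Fin n → ℤ) →
    ∑ (λ i → a * f i + b * g i) ≡ a * ∑ f + b * ∑ g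
  ∑-linear a b f g =
    trans (∑-+ (λ i → a * f i) (λ i → b * g i)) (cong₂ _+_ (∑-* a f) (∑-* b g))

  ∑-sub : ∀ {n} (f g : Fin n → ℤ) → ∑ (λ i → f i - g i) ≡ ∑ f - ∑ g
  ∑-sub f g = trans (∑-cong (λ i → pointwise (f i) (g i)))
    (trans (∑-linear 1ℤ -1ℤ f g) (sym (pointwise (∑ f) (∑ g))))
    where
    pointwise : ∀ a b → a - b ≡ 1ℤ * a + -1ℤ * b
    pointwise = solve-∀

  ∑-update : ∀ {n} {f g : Fin n → ℤ} v →
    (∀ u → u ≢ v → f u ≡ g u) → ∑ f + g v ≡ ∑ g + f v
  ∑-update v f≡g = ≤-antisym
    (∑-mono-except v λ u u≢v → ≤-reflexive (f≡g u u≢v))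
    (∑-mono-except v λ u u≢v → ≤-reflexive (sym (f≡g u u≢v)))

  term≤∑ : ∀ {n} {f : Fin n → ℤ} v → (∀ i → 0ℤ ≤ f i) → f v ≤ ∑ f
  term≤∑ {n} {f} v 0≤f = subst₂ _≤_ (trans (cong (_+ f v) (∑-zero n)) (+-identityˡ _))
    (+-identityʳ _) (∑-mono-except {f = λ _ → 0ℤ} {g = f} v λ u _ → 0≤f u)

  ⟦_⟧ : Bool → ℤ
  ⟦ false ⟧ = 0ℤ
  ⟦ true  ⟧ = 1ℤ

  0≤⟦⟧ : ∀ b → 0ℤ ≤ ⟦ b ⟧
  0≤⟦⟧ false = 0≤+
  0≤⟦⟧ true  = 0≤+

  ⟦⟧≤1 : ∀ b → ⟦ b ⟧ ≤ 1ℤ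
  ⟦⟧≤1 false = 0≤+
  ⟦⟧≤1 true  = ≤-refl

  ⟦⟧-idem : ∀ b → ⟦ b ⟧ * ⟦ b ⟧ ≡ ⟦ b ⟧
  ⟦⟧-idem false = refl
  ⟦⟧-idem true  = refl

  ⟦⟧*-congˡ : ∀ b {i j} → (b ≡ true → i ≡ j) → ⟦ b ⟧ * i ≡ ⟦ b ⟧ * j
  ⟦⟧*-congˡ false _   = refl
  ⟦⟧*-congˡ true  i≡j = cong (1ℤ *_) (i≡j refl)

  ⟦⟧*-monoˡ : ∀ b {i j} → (b ≡ true → i ≤ j) → ⟦ b ⟧ * i ≤ ⟦ b ⟧ * j
  ⟦⟧*-monoˡ false _   = ≤-refl
  ⟦⟧*-monoˡ true  i≤j = *-monoˡ-≤-nonNeg 1ℤ (i≤j refl)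

  ∑-atMostOne : ∀ {n} (b : Fin n → Bool) →
    (∀ i j → b i ≡ true → b j ≡ true → i ≡ j) → ∑ (λ i → ⟦ b i ⟧) ≤ 1ℤ
  ∑-atMostOne {zero}  b inj = ≤-trans (≤-reflexive (∑-empty _)) 0≤+
  ∑-atMostOne {suc n} b inj with b zero in b₀
  ... | false = ≤-trans (≤-reflexive (trans (∑-step _) (trans (cong (λ c → ⟦ c ⟧ + ∑ (λ i → ⟦ b (suc i) ⟧)) b₀) (+-identityˡ _))))
                  (∑-atMostOne (b ∘ suc) λ i j bi bj → suc-injective (inj (suc i) (suc j) bi bj))
  ... | true  = ≤-reflexive (trans (∑-step _) (cong₂ (λ c s → ⟦ c ⟧ + s) b₀ (trans (∑-cong rest) (∑-zero n))))
    where
    rest : ∀ i → ⟦ b (suc i) ⟧ ≡ 0ℤ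
    rest i with b (suc i) in bᵢ
    ... | false = refl
    ... | true  with () ← inj zero (suc i) b₀ bᵢ

  -- If every marked index had E f i ≥ c + 1, with E the number of marked indices, the marked sum
  -- multiplied by E would be at least (c + 1) E, which exceeds E c because E > 0. Multiplying by E
  -- replaces the division in the mean.
  average : ∀ {n} (b : Fin n → Bool) (f : Fin n → ℤ) c → 0ℤ < ∑ (λ i → ⟦ b i ⟧) →
    ∑ (λ i → ⟦ b i ⟧ * f i) ≤ c →
    ∃[ i ] (b i ≡ true × ∑ (λ j → ⟦ b j ⟧) * f i ≤ c)
  average {n} b f c 0<E ∑≤c
    with any? (λ i → (b i 𝔹ₚ.≟ true) ×-dec (∑ (λ j → ⟦ b j ⟧) * f i ≤? c))
  ... | yes found = found
  ... | no none   = ⊥-elim (<-irrefl refl (<-≤-trans (suc[i]≤j⇒i<j ≤-refl) (*-cancelˡ-≤-positive 0<E (begin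
      E * sucℤ c                        ≡⟨ *-comm E _ ⟩
      sucℤ c * E                        ≡⟨ sym (∑-* (sucℤ c) _) ⟩
      ∑ (λ i → sucℤ c * ⟦ b i ⟧)        ≤⟨ ∑-mono large ⟩
      ∑ (λ i → E * (⟦ b i ⟧ * f i))     ≡⟨ ∑-* E _ ⟩
      E * ∑ (λ i → ⟦ b i ⟧ * f i)       ≤⟨ *-monoˡ-≤-nonNeg E {{nonNegative (<⇒≤ 0<E)}} ∑≤c ⟩
      E * c                             ∎))))
    where
    open ≤-Reasoning
    E = ∑ (λ i → ⟦ b i ⟧)
    swap : ∀ a x y → a * (x * y) ≡ x * (a * y)
    swap = solve-∀
    large : ∀ i → sucℤ c * ⟦ b i ⟧ ≤ E * (⟦ b i ⟧ * f i)
    large i = begin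
      sucℤ c * ⟦ b i ⟧     ≡⟨ *-comm (sucℤ c) _ ⟩
      ⟦ b i ⟧ * sucℤ c     ≤⟨ ⟦⟧*-monoˡ (b i) (λ bi → i<j⇒suc[i]≤j (≰⇒> λ le → none (i , bi , le))) ⟩
      ⟦ b i ⟧ * (E * f i)  ≡⟨ swap ⟦ b i ⟧ E (f i) ⟩
      E * (⟦ b i ⟧ * f i)  ∎

-- Incidence systems in which two vertices determine the edge, and double counting.

module LinearSystems where

  open import Data.Bool.Base using (Bool; true; false; _∧_)
  open import Data.Bool.Properties using (∧-conicalˡ; ∧-conicalʳ)
  open import Data.Fin.Base using (Fin)
  import Data.Fin.Properties as Finₚ
  open import Data.Integer.Base
  open import Data.Integer.Properties
  open import Data.Integer.Tactic.RingSolver using (solve-∀)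
  open import Data.Nat.Base using (ℕ)
  open import Relation.Binary.PropositionalEquality hiding (J)
  open import Relation.Nullary.Decidable using (decidable-stable)
  open IntegerSums

  ⟦∧⟧ : ∀ a b → ⟦ a ∧ b ⟧ ≡ ⟦ a ⟧ * ⟦ b ⟧
  ⟦∧⟧ false b = refl
  ⟦∧⟧ true  b = sym (*-identityˡ ⟦ b ⟧)

  ∑-*³ : ∀ {n} a b (f : Fin n → ℤ) → ∑ (λ i → a * (b * f i)) ≡ a * (b * ∑ f)
  ∑-*³ a b f = trans (∑-* a _) (cong (a *_) (∑-* b f))

  ∑-square-+ : ∀ {n} m (f g : Fin n → ℤ) →
    ∑ (λ i → (m * f i + g i) * (m * f i + g i)) ≡
    m * m * ∑ (λ i → f i * f i) + (+ 2 * m * ∑ (λ i → f i * g i) + ∑ (λ i → g i * g i))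
  ∑-square-+ m f g = begin
    ∑ (λ i → (m * f i + g i) * (m * f i + g i))
      ≡⟨ ∑-cong (λ i → expand m (f i) (g i)) ⟩
    ∑ (λ i → m * m * (f i * f i) + 1ℤ * (+ 2 * m * (f i * g i) + 1ℤ * (g i * g i)))
      ≡⟨ ∑-linear (m * m) 1ℤ _ _ ⟩
    m * m * ∑ (λ i → f i * f i) + 1ℤ * ∑ (λ i → + 2 * m * (f i * g i) + 1ℤ * (g i * g i))
      ≡⟨ cong (λ s → m * m * ∑ (λ i → f i * f i) + s)
           (trans (*-identityˡ _) (trans (∑-linear (+ 2 * m) 1ℤ _ _)
             (cong (_+_ (+ 2 * m * ∑ (λ i → f i * g i))) (*-identityˡ _)))) ⟩
    m * m * ∑ (λ i → f i * f i) + (+ 2 * m * ∑ (λ i → f i * g i) + ∑ (λ i → g i * g i)) ∎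
    where
    open ≡-Reasoning
    expand : ∀ m a b → (m * a + b) * (m * a + b) ≡
      m * m * (a * a) + 1ℤ * (+ 2 * m * (a * b) + 1ℤ * (b * b))
    expand = solve-∀

  -- Edges are indices, so a set of edges is a Boolean function and can be changed one edge at a
  -- time. The form of `linear` is symmetric between edges and vertices: it yields both `meet≤1` for
  -- two edges and `codegree≤1` for two vertices.
  record LinearSystem (N n k : ℕ) : Set where
    field
      I       : Fin N → Fin n → Bool
      uniform : ∀ e → ∑ (λ v → ⟦ I e v ⟧) ≡ + k
      linear  : ∀ {e f u v} → I e u ≡ true → I e v ≡ true → I f u ≡ true → I f v ≡ true →
                u ≢ v → e ≡ f

    J : Fin N → Fin n → ℤ
    J e v = ⟦ I e v ⟧

    deg : (Fin N → Bool) → Fin n → ℤ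
    deg x v = ∑ λ e → ⟦ x e ⟧ * J e v

    meet : Fin N → Fin N → ℤ
    meet e f = ∑ λ v → J e v * J f v

    0≤J : ∀ e v → 0ℤ ≤ J e v
    0≤J e v = 0≤⟦⟧ (I e v)

    0≤deg : ∀ x v → 0ℤ ≤ deg x v
    0≤deg x v = 0≤∑ λ e → 0≤⟦⟧ (x e) ⊛ 0≤J e v

    meet-comm : ∀ e f → meet e f ≡ meet f e
    meet-comm e f = ∑-cong λ v → *-comm (J e v) (J f v)

    0≤meet : ∀ e f → 0ℤ ≤ meet e f
    0≤meet e f = 0≤∑ λ v → 0≤J e v ⊛ 0≤J f v

    J*J≤meet : ∀ e f v → J e v * J f v ≤ meet e f
    J*J≤meet e f v = term≤∑ v λ u → 0≤J e u ⊛ 0≤J f u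

    meet≤1 : ∀ e f → e ≢ f → meet e f ≤ 1ℤ
    meet≤1 e f e≢f = subst (_≤ 1ℤ) (∑-cong λ v → ⟦∧⟧ (I e v) (I f v))
      (∑-atMostOne (λ v → I e v ∧ I f v) one)
      where
      one : ∀ u v → I e u ∧ I f u ≡ true → I e v ∧ I f v ≡ true → u ≡ v
      one u v p q = decidable-stable (u Finₚ.≟ v) λ u≢v → e≢f
        (linear (∧-conicalˡ _ _ p) (∧-conicalˡ _ _ q) (∧-conicalʳ _ _ p) (∧-conicalʳ _ _ q) u≢v)

    codegree≤1 : ∀ (x : Fin N → Bool) u v → u ≢ v → ∑ (λ e → ⟦ x e ⟧ * (J e u * J e v)) ≤ 1ℤ
    codegree≤1 x u v u≢v = subst (_≤ 1ℤ)
      (∑-cong λ e → trans (⟦∧⟧ (x e) _) (cong (⟦ x e ⟧ *_) (⟦∧⟧ (I e u) (I e v))))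
      (∑-atMostOne (λ e → x e ∧ (I e u ∧ I e v)) one)
      where
      one : ∀ e f → x e ∧ (I e u ∧ I e v) ≡ true → x f ∧ (I f u ∧ I f v) ≡ true → e ≡ f
      one e f p q = linear (∧-conicalˡ _ _ p′) (∧-conicalʳ _ _ p′) (∧-conicalˡ _ _ q′) (∧-conicalʳ _ _ q′) u≢v
        where
        p′ = ∧-conicalʳ (x e) _ p
        q′ = ∧-conicalʳ (x f) _ q

    double-count : ∀ (x : Fin N → Bool) (g : Fin n → ℤ) →
      ∑ (λ e → ⟦ x e ⟧ * ∑ (λ v → J e v * g v)) ≡ ∑ (λ v → deg x v * g v)
    double-count x g = begin
      ∑ (λ e → ⟦ x e ⟧ * ∑ (λ v → J e v * g v))    ≡⟨ ∑-cong (λ e → sym (∑-* ⟦ x e ⟧ _)) ⟩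
      ∑ (λ e → ∑ λ v → ⟦ x e ⟧ * (J e v * g v))    ≡⟨ ∑-swap _ ⟩
      ∑ (λ v → ∑ λ e → ⟦ x e ⟧ * (J e v * g v))    ≡⟨ ∑-cong (λ v → trans
                                                       (∑-cong λ e → regroup ⟦ x e ⟧ (J e v) (g v))
                                                       (trans (∑-* (g v) _) (*-comm (g v) _))) ⟩
      ∑ (λ v → deg x v * g v)                      ∎
      where
      open ≡-Reasoning
      regroup : ∀ a b c → a * (b * c) ≡ c * (a * b)
      regroup = solve-∀

    ∑-deg : ∀ (x : Fin N → Bool) → ∑ (deg x) ≡ + k * ∑ (λ e → ⟦ x e ⟧)
    ∑-deg x = begin
      ∑ (deg x)                                    ≡⟨ ∑-cong (λ v → sym (*-identityʳ (deg x v))) ⟩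
      ∑ (λ v → deg x v * 1ℤ)                       ≡⟨ sym (double-count x (λ _ → 1ℤ)) ⟩
      ∑ (λ e → ⟦ x e ⟧ * ∑ (λ v → J e v * 1ℤ))     ≡⟨ ∑-cong (λ e → trans (*-comm ⟦ x e ⟧ _) (cong (_* ⟦ x e ⟧)
                                                       (trans (∑-cong λ v → *-identityʳ (J e v)) (uniform e)))) ⟩
      ∑ (λ e → + k * ⟦ x e ⟧)                      ≡⟨ ∑-* (+ k) _ ⟩
      + k * ∑ (λ e → ⟦ x e ⟧)                      ∎
      where open ≡-Reasoning

-- The expected change of the degree variance when one edge joins the matching.

module GreedyStep where

  open import Data.Bool.Base using (Bool; true; false)
  open import Data.Fin.Base using (Fin)
  open import Data.Integer.Base
  open import Data.Integer.Properties
  open import Data.Integer.Tactic.RingSolver using (solve-∀)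
  open import Data.Nat.Base as ℕ using (ℕ)
  open import Relation.Binary.PropositionalEquality hiding (J)
  open IntegerSums
  open LinearSystems

  -- `x` marks the active edges, those still disjoint from the matching, and `y` the alive vertices,
  -- those not yet covered.
  module Step {N n k : ℕ} (L : LinearSystem N n k)
    (x : Fin N → Bool) (y : Fin n → Bool) (q P : ℤ)
    (alive : ∀ e v → x e ≡ true → LinearSystem.I L e v ≡ true → y v ≡ true)
    where

    open LinearSystem L

    d : Fin n → ℤ
    d = deg x

    X : Fin N → ℤ
    X e = ⟦ x e ⟧

    Y : Fin n → ℤ
    Y v = ⟦ y v ⟧

    m E : ℤ
    m = ∑ Y
    E = ∑ X

    -- P / q is the degree that the alive vertices should have at this stage;
    -- deviations are multiplied by q to stay integral.
    δ : Fin n → ℤ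
    δ v = q * d v - P * Y v

    S V Θ : ℤ
    S = ∑ δ
    V = ∑ λ v → δ v * δ v
    Θ = ∑ λ v → δ v * (δ v * δ v)

    T : Fin N → ℤ
    T f = ∑ λ v → J f v * δ v

    -- The number of active edges through v that meet e, for v outside e.
    lost : Fin N → Fin n → ℤ
    lost e v = ∑ (λ f → X f * (J f v * meet f e)) - J e v * d v

    XJY≡XJ : ∀ e v → X e * J e v * Y v ≡ X e * J e v
    XJY≡XJ e v with x e in xe | I e v in ev
    ... | false | _     = refl
    ... | true  | false = refl
    ... | true  | true  = cong (λ b → 1ℤ * ⟦ b ⟧) (alive e v xe ev)

    dY≡d : ∀ v → d v * Y v ≡ d v
    dY≡d v = begin
      d v * Y v                        ≡⟨ *-comm (d v) (Y v) ⟩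
      Y v * d v                        ≡⟨ sym (∑-* (Y v) _) ⟩
      ∑ (λ e → Y v * (X e * J e v))    ≡⟨ ∑-cong (λ e → trans (*-comm (Y v) _) (XJY≡XJ e v)) ⟩
      d v                              ∎
      where open ≡-Reasoning

    δY≡δ : ∀ v → δ v * Y v ≡ δ v
    δY≡δ v = trans (expand q (d v) P (Y v))
      (cong₂ (λ a b → q * a - P * b) (dY≡d v) (⟦⟧-idem (y v)))
      where
      expand : ∀ q d P Y → (q * d - P * Y) * Y ≡ q * (d * Y) - P * (Y * Y)
      expand = solve-∀

    qd≡δ+PY : ∀ v → q * d v ≡ δ v + P * Y v
    qd≡δ+PY v = cancel (q * d v) (P * Y v)
      where
      cancel : ∀ a b → a ≡ (a - b) + b
      cancel = solve-∀

    t : Fin N → ℤ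
    t f = ∑ λ v → J f v * d v

    X*t : ∀ f → X f * (q * t f) ≡ X f * (T f + P * + k)
    X*t f = ⟦⟧*-congˡ (x f) λ xf → begin
      q * t f                                ≡⟨ sym (∑-* q _) ⟩
      ∑ (λ v → q * (J f v * d v))            ≡⟨ ∑-cong (λ v → pointwise xf v) ⟩
      ∑ (λ v → 1ℤ * (J f v * δ v) + P * J f v) ≡⟨ ∑-linear 1ℤ P _ _ ⟩
      1ℤ * T f + P * ∑ (J f)                 ≡⟨ cong₂ (λ a b → a + P * b) (*-identityˡ (T f)) (uniform f) ⟩
      T f + P * + k                          ∎
      where
      open ≡-Reasoning
      JY≡J : x f ≡ true → ∀ v → J f v * Y v ≡ J f v
      JY≡J xf v = subst (λ b → ⟦ b ⟧ * J f v * Y v ≡ ⟦ b ⟧ * J f v → J f v * Y v ≡ J f v) (sym xf)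
        (λ h → trans (cong (_* Y v) (sym (*-identityˡ (J f v)))) (trans h (*-identityˡ (J f v))))
        (XJY≡XJ f v)
      swap : ∀ a b c → a * (b * c) ≡ b * (a * c)
      swap = solve-∀
      expand : ∀ j a P Y → j * (a + P * Y) ≡ 1ℤ * (j * a) + P * (j * Y)
      expand = solve-∀
      pointwise : x f ≡ true → ∀ v → q * (J f v * d v) ≡ 1ℤ * (J f v * δ v) + P * J f v
      pointwise xf v = begin
        q * (J f v * d v)                    ≡⟨ swap q (J f v) (d v) ⟩
        J f v * (q * d v)                    ≡⟨ cong (J f v *_) (qd≡δ+PY v) ⟩
        J f v * (δ v + P * Y v)              ≡⟨ expand (J f v) (δ v) P (Y v) ⟩
        1ℤ * (J f v * δ v) + P * (J f v * Y v) ≡⟨ cong (λ a → 1ℤ * (J f v * δ v) + P * a) (JY≡J xf v) ⟩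
        1ℤ * (J f v * δ v) + P * J f v       ∎

    -- Exchange the order of summation: for a fixed edge f through v, the total of `meet f e` over
    -- active e counts the pairs of a vertex of f and an active edge at it, which is `t f`.
    ∑-lost : ∀ v → ∑ (λ e → X e * lost e v) ≡ ∑ (λ f → X f * (J f v * t f)) - d v * d v
    ∑-lost v = begin
      ∑ (λ e → X e * lost e v)
        ≡⟨ ∑-cong (λ e → expand (X e) _ (J e v) (d v)) ⟩
      ∑ (λ e → X e * ∑ (λ f → X f * (J f v * meet f e)) - d v * (X e * J e v))
        ≡⟨ ∑-sub _ _ ⟩
      ∑ (λ e → X e * ∑ (λ f → X f * (J f v * meet f e))) - ∑ (λ e → d v * (X e * J e v))
        ≡⟨ cong₂ _-_ swapped (∑-* (d v) _) ⟩
      ∑ (λ f → X f * (J f v * t f)) - d v * d v ∎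
      where
      open ≡-Reasoning
      expand : ∀ a s j d → a * (s - j * d) ≡ a * s - d * (a * j)
      expand = solve-∀
      regroup : ∀ a b c m → a * (b * (c * m)) ≡ b * (c * (a * m))
      regroup = solve-∀
      swapped : ∑ (λ e → X e * ∑ (λ f → X f * (J f v * meet f e))) ≡ ∑ (λ f → X f * (J f v * t f))
      swapped = begin
        ∑ (λ e → X e * ∑ (λ f → X f * (J f v * meet f e)))
          ≡⟨ ∑-cong (λ e → sym (∑-* (X e) _)) ⟩
        ∑ (λ e → ∑ λ f → X e * (X f * (J f v * meet f e)))
          ≡⟨ ∑-swap _ ⟩
        ∑ (λ f → ∑ λ e → X e * (X f * (J f v * meet f e)))
          ≡⟨ ∑-cong (λ f → trans (∑-cong λ e → regroup (X e) (X f) (J f v) (meet f e)) (∑-*³ (X f) (J f v) _)) ⟩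
        ∑ (λ f → X f * (J f v * ∑ (λ e → X e * meet f e)))
          ≡⟨ ∑-cong (λ f → cong (λ s → X f * (J f v * s)) (begin
               ∑ (λ e → X e * meet f e)                    ≡⟨ ∑-cong (λ e → cong (X e *_) (meet-comm f e)) ⟩
               ∑ (λ e → X e * ∑ (λ v → J e v * J f v))     ≡⟨ double-count x (J f) ⟩
               ∑ (λ v → d v * J f v)                       ≡⟨ ∑-cong (λ v → *-comm (d v) (J f v)) ⟩
               t f                                         ∎)) ⟩
        ∑ (λ f → X f * (J f v * t f)) ∎

    Q : ℤ
    Q = ∑ λ f → X f * (T f * T f)

    -- Replacing q d by δ + P Y turns every sum into a power sum of δ. The only part that sees the
    -- structure of the system is `Q`, and it is a sum of squares.
    ∑-δ-lost : q * q * ∑ (λ v → δ v * ∑ (λ e → X e * lost e v)) ≡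
      q * Q + + k * P * (V + P * S) - (Θ + + 2 * P * V + P * P * S)
    ∑-δ-lost = begin
      q * q * ∑ (λ v → δ v * ∑ (λ e → X e * lost e v))
        ≡⟨ cong (q * q *_) split ⟩
      q * q * (∑ (λ f → X f * (T f * t f)) - ∑ (λ v → δ v * (d v * d v)))
        ≡⟨ expand q _ _ ⟩
      q * (q * ∑ (λ f → X f * (T f * t f))) - q * q * ∑ (λ v → δ v * (d v * d v))
        ≡⟨ cong₂ (λ a b → q * a - b) first second ⟩
      q * (Q + P * + k * ∑ (λ v → d v * δ v)) - (Θ + + 2 * P * V + P * P * S)
        ≡⟨ expand′ q Q P (+ k) _ _ ⟩
      q * Q + P * + k * (q * ∑ (λ v → d v * δ v)) - (Θ + + 2 * P * V + P * P * S)
        ≡⟨ cong (λ s → q * Q + s - (Θ + + 2 * P * V + P * P * S))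
             (trans (cong (P * + k *_) third) (cong (_* (V + P * S)) (*-comm P (+ k)))) ⟩
      q * Q + + k * P * (V + P * S) - (Θ + + 2 * P * V + P * P * S) ∎
      where
      open ≡-Reasoning
      expand : ∀ q a b → q * q * (a - b) ≡ q * (q * a) - q * q * b
      expand = solve-∀
      expand′ : ∀ q a P k s b → q * (a + P * k * s) - b ≡ q * a + P * k * (q * s) - b
      expand′ = solve-∀

      split : ∑ (λ v → δ v * ∑ (λ e → X e * lost e v)) ≡
        ∑ (λ f → X f * (T f * t f)) - ∑ (λ v → δ v * (d v * d v))
      split = begin
        ∑ (λ v → δ v * ∑ (λ e → X e * lost e v))
          ≡⟨ ∑-cong (λ v → trans (cong (δ v *_) (∑-lost v)) (*-distribˡ-- (δ v) _ _)) ⟩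
        ∑ (λ v → δ v * ∑ (λ f → X f * (J f v * t f)) - δ v * (d v * d v))
          ≡⟨ ∑-sub _ _ ⟩
        ∑ (λ v → δ v * ∑ (λ f → X f * (J f v * t f))) - ∑ (λ v → δ v * (d v * d v))
          ≡⟨ cong (_- ∑ (λ v → δ v * (d v * d v))) (begin
               ∑ (λ v → δ v * ∑ (λ f → X f * (J f v * t f)))  ≡⟨ ∑-cong (λ v → sym (∑-* (δ v) _)) ⟩
               ∑ (λ v → ∑ λ f → δ v * (X f * (J f v * t f)))  ≡⟨ ∑-swap _ ⟩
               ∑ (λ f → ∑ λ v → δ v * (X f * (J f v * t f)))
                 ≡⟨ ∑-cong (λ f → trans (∑-cong λ v → regroup (δ v) (X f) (J f v) (t f))
                      (trans (∑-*³ (X f) (t f) _) (cong (X f *_) (*-comm (t f) (T f))))) ⟩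
               ∑ (λ f → X f * (T f * t f)) ∎) ⟩
        ∑ (λ f → X f * (T f * t f)) - ∑ (λ v → δ v * (d v * d v)) ∎
        where
        regroup : ∀ a x j t → a * (x * (j * t)) ≡ x * (t * (j * a))
        regroup = solve-∀
        *-distribˡ-- : ∀ a b c → a * (b - c) ≡ a * b - a * c
        *-distribˡ-- = solve-∀

      first : q * ∑ (λ f → X f * (T f * t f)) ≡ Q + P * + k * ∑ (λ v → d v * δ v)
      first = begin
        q * ∑ (λ f → X f * (T f * t f))         ≡⟨ sym (∑-* q _) ⟩
        ∑ (λ f → q * (X f * (T f * t f)))       ≡⟨ ∑-cong (λ f → regroup q (X f) (T f) (t f)) ⟩
        ∑ (λ f → T f * (X f * (q * t f)))       ≡⟨ ∑-cong (λ f → cong (T f *_) (X*t f)) ⟩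
        ∑ (λ f → T f * (X f * (T f + P * + k))) ≡⟨ ∑-cong (λ f → distribute (T f) (X f) (P * + k)) ⟩
        ∑ (λ f → 1ℤ * (X f * (T f * T f)) + P * + k * (X f * T f))
                                                ≡⟨ ∑-linear 1ℤ (P * + k) _ _ ⟩
        1ℤ * Q + P * + k * ∑ (λ f → X f * T f)  ≡⟨ cong₂ (λ a b → a + P * + k * b) (*-identityˡ Q) (double-count x δ) ⟩
        Q + P * + k * ∑ (λ v → d v * δ v)       ∎
        where
        regroup : ∀ q x T t → q * (x * (T * t)) ≡ T * (x * (q * t))
        regroup = solve-∀
        distribute : ∀ T x a → T * (x * (T + a)) ≡ 1ℤ * (x * (T * T)) + a * (x * T)
        distribute = solve-∀

      second : q * q * ∑ (λ v → δ v * (d v * d v)) ≡ Θ + + 2 * P * V + P * P * S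
      second = begin
        q * q * ∑ (λ v → δ v * (d v * d v))   ≡⟨ sym (∑-* (q * q) _) ⟩
        ∑ (λ v → q * q * (δ v * (d v * d v))) ≡⟨ ∑-cong pointwise ⟩
        ∑ (λ v → 1ℤ * (δ v * (δ v * δ v)) + 1ℤ * (+ 2 * P * (δ v * δ v) + P * P * δ v))
                                              ≡⟨ ∑-linear 1ℤ 1ℤ _ _ ⟩
        1ℤ * Θ + 1ℤ * ∑ (λ v → + 2 * P * (δ v * δ v) + P * P * δ v)
                                              ≡⟨ cong (λ s → 1ℤ * Θ + 1ℤ * s) (∑-linear (+ 2 * P) (P * P) _ _) ⟩
        1ℤ * Θ + 1ℤ * (+ 2 * P * V + P * P * S) ≡⟨ collect Θ (+ 2 * P * V) (P * P * S) ⟩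
        Θ + + 2 * P * V + P * P * S           ∎
        where
        collect : ∀ a b c → 1ℤ * a + 1ℤ * (b + c) ≡ a + b + c
        collect = solve-∀
        regroup : ∀ q a d → q * q * (a * (d * d)) ≡ a * ((q * d) * (q * d))
        regroup = solve-∀
        distribute : ∀ a P Y → a * ((a + P * Y) * (a + P * Y)) ≡
          a * (a * a) + + 2 * P * (a * (a * Y)) + P * P * (a * Y * Y)
        distribute = solve-∀
        collect′ : ∀ a b c → a + b + c ≡ 1ℤ * a + 1ℤ * (b + c)
        collect′ = solve-∀
        pointwise : ∀ v → q * q * (δ v * (d v * d v)) ≡
          1ℤ * (δ v * (δ v * δ v)) + 1ℤ * (+ 2 * P * (δ v * δ v) + P * P * δ v)
        pointwise v = begin
          q * q * (δ v * (d v * d v))                     ≡⟨ regroup q (δ v) (d v) ⟩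
          δ v * ((q * d v) * (q * d v))                   ≡⟨ cong (λ a → δ v * (a * a)) (qd≡δ+PY v) ⟩
          δ v * ((δ v + P * Y v) * (δ v + P * Y v))       ≡⟨ distribute (δ v) P (Y v) ⟩
          δ v * (δ v * δ v) + + 2 * P * (δ v * (δ v * Y v)) + P * P * (δ v * Y v * Y v)
            ≡⟨ cong₂ (λ a b → δ v * (δ v * δ v) + + 2 * P * (δ v * a) + P * P * b)
                 (δY≡δ v) (trans (cong (_* Y v) (δY≡δ v)) (δY≡δ v)) ⟩
          δ v * (δ v * δ v) + + 2 * P * (δ v * δ v) + P * P * δ v
            ≡⟨ collect′ (δ v * (δ v * δ v)) (+ 2 * P * (δ v * δ v)) (P * P * δ v) ⟩
          1ℤ * (δ v * (δ v * δ v)) + 1ℤ * (+ 2 * P * (δ v * δ v) + P * P * δ v) ∎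

      third : q * ∑ (λ v → d v * δ v) ≡ V + P * S
      third = begin
        q * ∑ (λ v → d v * δ v)                  ≡⟨ sym (∑-* q _) ⟩
        ∑ (λ v → q * (d v * δ v))                ≡⟨ ∑-cong pointwise ⟩
        ∑ (λ v → 1ℤ * (δ v * δ v) + P * δ v)     ≡⟨ ∑-linear 1ℤ P _ _ ⟩
        1ℤ * V + P * S                           ≡⟨ cong (_+ P * S) (*-identityˡ V) ⟩
        V + P * S                                ∎
        where
        distribute : ∀ a P Y → (a + P * Y) * a ≡ 1ℤ * (a * a) + P * (a * Y)
        distribute = solve-∀
        pointwise : ∀ v → q * (d v * δ v) ≡ 1ℤ * (δ v * δ v) + P * δ v
        pointwise v = trans (sym (*-assoc q (d v) (δ v))) (trans (cong (_* δ v) (qd≡δ+PY v))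
          (trans (distribute (δ v) P (Y v)) (cong (λ a → 1ℤ * (δ v * δ v) + P * a) (δY≡δ v))))

    -- `R` / (q m) is k (k - 1) p / m with p = P / q: the mean loss at a vertex, over all edges, in
    -- a system regular of degree p. Thus `w` is q m times the predicted loss minus the actual one.
    R : ℤ
    R = + k * (+ k - 1ℤ) * P

    w : Fin N → Fin n → ℤ
    w e v = R * Y v - q * m * lost e v

    -- Bounds the new variance if e joins the matching: the new deviations are
    -- m * δ v + w e v off e, and 0 on e.
    G : Fin N → ℤ
    G e = ∑ λ v → (m * δ v + w e v) * (m * δ v + w e v)

    0≤m : 0ℤ ≤ m
    0≤m = 0≤∑ λ v → 0≤⟦⟧ (y v)

    0≤V : 0ℤ ≤ V
    0≤V = 0≤∑ λ v → 0≤square (δ v)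

    0≤Q : 0ℤ ≤ Q
    0≤Q = 0≤∑ λ f → 0≤⟦⟧ (x f) ⊛ 0≤square (T f)

    kqE≡S+Pm : + k * (q * E) ≡ S + P * m
    kqE≡S+Pm = begin
      + k * (q * E)                       ≡⟨ swap (+ k) q E ⟩
      q * (+ k * E)                       ≡⟨ cong (q *_) (sym (∑-deg x)) ⟩
      q * ∑ d                             ≡⟨ sym (∑-* q d) ⟩
      ∑ (λ v → q * d v)                   ≡⟨ ∑-cong qd≡δ+PY ⟩
      ∑ (λ v → δ v + P * Y v)             ≡⟨ trans (∑-+ δ _) (cong (_+_ S) (∑-* P Y)) ⟩
      S + P * m                           ∎
      where
      open ≡-Reasoning
      swap : ∀ a b c → a * (b * c) ≡ b * (a * c)
      swap = solve-∀

    -- Cauchy-Schwarz on the alive vertices, outside which δ vanishes: the sum of the squares of m δ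
    -- - S Y equals m (m V - S²).
    S²≤mV : 0ℤ < m → S * S ≤ m * V
    S²≤mV 0<m = *-cancelˡ-≤-positive 0<m (≤-from-difference _
      (0≤∑ λ v → 0≤square (m * δ v + - S * Y v))
      (trans (expand m V S) (cong (_+_ (m * (S * S)))
        (sym (trans (∑-square-+ m δ (λ v → - S * Y v))
          (cong₂ (λ a b → m * m * V + (+ 2 * m * a + b)) mixed squared))))))
      where
      swap : ∀ s a b → a * (- s * b) ≡ - s * (a * b)
      swap = solve-∀
      swap′ : ∀ s b → (- s * b) * (- s * b) ≡ s * s * (b * b)
      swap′ = solve-∀
      mixed : ∑ (λ v → δ v * (- S * Y v)) ≡ - S * S
      mixed = trans (∑-cong λ v → trans (swap S (δ v) (Y v)) (cong (- S *_) (δY≡δ v))) (∑-* (- S) δ)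
      squared : ∑ (λ v → (- S * Y v) * (- S * Y v)) ≡ S * S * m
      squared = trans (∑-cong λ v → trans (swap′ S (Y v)) (cong (S * S *_) (⟦⟧-idem (y v)))) (∑-* (S * S) Y)
      expand : ∀ m V S → m * (m * V) ≡ m * (S * S) + (m * m * V + (+ 2 * m * (- S * S) + S * S * m))
      expand = solve-∀

    -- By Cauchy-Schwarz the hypothesis on `V` forces S ≥ - P m / 2. The handshake identity
    -- `kqE≡S+Pm` then leaves at least half of the edges that degree P / q would give.
    Pm≤2kqE : 0ℤ < m → 0ℤ < P → + 4 * V ≤ P * P * m → P * m ≤ + 2 * (+ k * (q * E))
    Pm≤2kqE 0<m 0<P V-small = *-cancelˡ-≤-positive
      (0<* 0<P 0<m)
      (subst (λ s → P * m * (P * m) ≤ P * m * (+ 2 * s)) (sym kqE≡S+Pm)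
        (*-cancelˡ-≤-positive {+ 2} (+<+ (ℕ.s≤s ℕ.z≤n)) (≤-from-difference _
          (0≤square (P * m + + 2 * S) ⊕
           0≤m ⊛ 0≤difference V-small ⊕ 0≤+ {4} ⊛ 0≤difference (S²≤mV 0<m))
          (expand P m S V))))
      where
      expand : ∀ P m S V → + 2 * (P * m * (+ 2 * (S + P * m))) ≡ + 2 * (P * m * (P * m)) +
        ((P * m + + 2 * S) * (P * m + + 2 * S) + m * (P * P * m - + 4 * V) + + 4 * (m * V - S * S))
      expand = solve-∀

    Λ : ℤ
    Λ = ∑ λ e → X e * ∑ (λ v → δ v * w e v)

    Λ-split : Λ ≡ R * S * E - q * m * ∑ (λ v → δ v * ∑ (λ e → X e * lost e v))
    Λ-split = begin
      Λ ≡⟨ ∑-cong (λ e → cong (X e *_) (inner e)) ⟩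
      ∑ (λ e → X e * (R * S - q * m * ∑ (λ v → δ v * lost e v)))
        ≡⟨ ∑-cong (λ e → distribute (X e) (R * S) (q * m) _) ⟩
      ∑ (λ e → R * S * X e - q * m * (X e * ∑ (λ v → δ v * lost e v)))
        ≡⟨ trans (∑-sub _ _) (cong₂ _-_ (∑-* (R * S) X) (∑-* (q * m) _)) ⟩
      R * S * E - q * m * ∑ (λ e → X e * ∑ (λ v → δ v * lost e v))
        ≡⟨ cong (λ s → R * S * E - q * m * s) (begin
             ∑ (λ e → X e * ∑ (λ v → δ v * lost e v))   ≡⟨ ∑-cong (λ e → sym (∑-* (X e) _)) ⟩
             ∑ (λ e → ∑ λ v → X e * (δ v * lost e v))   ≡⟨ ∑-swap _ ⟩
             ∑ (λ v → ∑ λ e → X e * (δ v * lost e v))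
               ≡⟨ ∑-cong (λ v → trans (∑-cong λ e → swap (X e) (δ v) (lost e v)) (∑-* (δ v) _)) ⟩
             ∑ (λ v → δ v * ∑ (λ e → X e * lost e v))   ∎) ⟩
      R * S * E - q * m * ∑ (λ v → δ v * ∑ (λ e → X e * lost e v)) ∎
      where
      open ≡-Reasoning
      swap : ∀ a b c → a * (b * c) ≡ b * (a * c)
      swap = solve-∀
      distribute : ∀ a r b s → a * (r - b * s) ≡ r * a - b * (a * s)
      distribute = solve-∀
      expand : ∀ a r Y b l → a * (r * Y - b * l) ≡ r * (a * Y) - b * (a * l)
      expand = solve-∀
      inner : ∀ e → ∑ (λ v → δ v * w e v) ≡ R * S - q * m * ∑ (λ v → δ v * lost e v)
      inner e = trans
        (∑-cong λ v → trans (expand (δ v) R (Y v) (q * m) (lost e v))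
          (cong (λ a → R * a - q * m * (δ v * lost e v)) (δY≡δ v)))
        (trans (∑-sub _ _) (cong₂ _-_ (∑-* R δ) (∑-* (q * m) _)))

    module _ (1≤k : 1 ℕ.≤ k) (0<q : 0ℤ < q) (0≤P : 0ℤ ≤ P) (0<m : 0ℤ < m)
      (Δ : ℤ) (deg≤Δ : ∀ v → d v ≤ Δ) where

      0≤k-1 : 0ℤ ≤ + k - 1ℤ
      0≤k-1 = 0≤difference (+≤+ 1≤k)

      0≤q : 0ℤ ≤ q
      0≤q = <⇒≤ 0<q

      0≤R : 0ℤ ≤ R
      0≤R = (0≤+ {k} ⊛ 0≤k-1) ⊛ 0≤P

      -- The cubic moment has no sign of its own, but together with P V it is the sum of (δ + P Y)
      -- δ² = q d δ², where the degree bound applies.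
      Θ+PV≤ : Θ + P * V ≤ q * Δ * V
      Θ+PV≤ = begin
        Θ + P * V                                       ≡⟨ cong (_+_ Θ) (sym (∑-* P _)) ⟩
        Θ + ∑ (λ v → P * (δ v * δ v))                   ≡⟨ sym (∑-+ _ _) ⟩
        ∑ (λ v → δ v * (δ v * δ v) + P * (δ v * δ v))   ≤⟨ ∑-mono pointwise ⟩
        ∑ (λ v → q * Δ * (δ v * δ v))                   ≡⟨ ∑-* (q * Δ) _ ⟩
        q * Δ * V                                       ∎
        where
        open ≤-Reasoning
        collect : ∀ a P Y → a * (a * a) + P * (a * (a * Y)) ≡ (a + P * Y) * (a * a)
        collect = solve-∀
        pointwise : ∀ v → δ v * (δ v * δ v) + P * (δ v * δ v) ≤ q * Δ * (δ v * δ v)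
        pointwise v = begin
          δ v * (δ v * δ v) + P * (δ v * δ v)
            ≡⟨ cong (λ a → δ v * (δ v * δ v) + P * (δ v * a)) (sym (δY≡δ v)) ⟩
          δ v * (δ v * δ v) + P * (δ v * (δ v * Y v))   ≡⟨ collect (δ v) P (Y v) ⟩
          (δ v + P * Y v) * (δ v * δ v)                 ≡⟨ cong (_* (δ v * δ v)) (sym (qd≡δ+PY v)) ⟩
          q * d v * (δ v * δ v)
            ≤⟨ *-monoʳ-≤-nonNeg (δ v * δ v) {{nonNegative (0≤square (δ v))}}
                 (*-monoˡ-≤-nonNeg q {{nonNegative 0≤q}} (deg≤Δ v)) ⟩
          q * Δ * (δ v * δ v)                           ∎

      -- The adjacency form of δ equals Q - ∑ d δ²; as Q ≥ 0 it cannot push the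
      -- variance up, and only the maximum degree enters.
      Λ≤ : Λ ≤ m * Δ * V
      Λ≤ = *-cancelˡ-≤-positive 0<q (≤-from-difference _
        ((0≤k-1 ⊛ 0≤P) ⊛ 0≤difference (S²≤mV 0<m) ⊕ 0≤m ⊛ (0≤q ⊛ 0≤Q) ⊕ 0≤m ⊛ 0≤difference Θ+PV≤)
        (begin
          q * (m * Δ * V)
            ≡⟨ expand (+ k) P m q Q V S Θ Δ ⟩
          (+ k - 1ℤ) * P * S * (S + P * m) - m * Z + D
            ≡⟨ cong₂ (λ a b → (+ k - 1ℤ) * P * S * a - m * b + D) (sym kqE≡S+Pm) (sym ∑-δ-lost) ⟩
          (+ k - 1ℤ) * P * S * (+ k * (q * E)) - m * (q * q * W) + D
            ≡⟨ cong (_+ D) (collect (+ k) P S q E m W) ⟩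
          q * (R * S * E - q * m * W) + D
            ≡⟨ cong (λ a → q * a + D) (sym Λ-split) ⟩
          q * Λ + D ∎))
        where
        open ≡-Reasoning
        W Z D : ℤ
        W = ∑ λ v → δ v * ∑ (λ e → X e * lost e v)
        Z = q * Q + + k * P * (V + P * S) - (Θ + + 2 * P * V + P * P * S)
        D = (+ k - 1ℤ) * P * (m * V - S * S) + m * (q * Q) + m * (q * Δ * V - (Θ + P * V))
        expand : ∀ k P m q Q V S Θ Δ → q * (m * Δ * V) ≡
          (k - 1ℤ) * P * S * (S + P * m)
            - m * (q * Q + k * P * (V + P * S) - (Θ + + 2 * P * V + P * P * S))
            + ((k - 1ℤ) * P * (m * V - S * S) + m * (q * Q) + m * (q * Δ * V - (Θ + P * V)))
        expand = solve-∀
        collect : ∀ k P S q E m W → (k - 1ℤ) * P * S * (k * (q * E)) - m * (q * q * W) ≡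
          q * (k * (k - 1ℤ) * P * S * E - q * m * W)
        collect = solve-∀

      lost-through : ∀ e v → ∑ (λ f → X f * (J f v * meet f e)) ≡
        ∑ (λ u → J e u * ∑ (λ f → X f * (J f u * J f v)))
      lost-through e v = begin
        ∑ (λ f → X f * (J f v * meet f e))
          ≡⟨ ∑-cong (λ f → sym (∑-*³ (X f) (J f v) _)) ⟩
        ∑ (λ f → ∑ λ u → X f * (J f v * (J f u * J e u)))
          ≡⟨ ∑-swap _ ⟩
        ∑ (λ u → ∑ λ f → X f * (J f v * (J f u * J e u)))
          ≡⟨ ∑-cong (λ u → trans (∑-cong λ f → regroup (X f) (J f v) (J f u) (J e u)) (∑-* (J e u) _)) ⟩
        ∑ (λ u → J e u * ∑ (λ f → X f * (J f u * J f v))) ∎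
        where
        open ≡-Reasoning
        regroup : ∀ x a b c → x * (a * (b * c)) ≡ c * (x * (b * a))
        regroup = solve-∀

      0≤lost : ∀ e v → 0ℤ ≤ lost e v
      0≤lost e v = 0≤difference (begin
        J e v * d v                              ≡⟨ sym (∑-* (J e v) _) ⟩
        ∑ (λ f → J e v * (X f * J f v))          ≤⟨ ∑-mono pointwise ⟩
        ∑ (λ f → X f * (J f v * meet f e))       ∎)
        where
        open ≤-Reasoning
        regroup : ∀ a x b → a * (x * b) ≡ x * (b * a)
        regroup = solve-∀
        pointwise : ∀ f → J e v * (X f * J f v) ≤ X f * (J f v * meet f e)
        pointwise f = begin
          J e v * (X f * J f v)            ≡⟨ regroup (J e v) (X f) (J f v) ⟩
          X f * (J f v * J e v)            ≡⟨ cong (λ a → X f * (a * J e v)) (sym (⟦⟧-idem (I f v))) ⟩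
          X f * (J f v * J f v * J e v)    ≡⟨ cong (X f *_) (*-assoc (J f v) (J f v) (J e v)) ⟩
          X f * (J f v * (J f v * J e v))
            ≤⟨ *-monoˡ-≤-nonNeg (X f) {{nonNegative (0≤⟦⟧ (x f))}}
                 (*-monoˡ-≤-nonNeg (J f v) {{nonNegative (0≤J f v)}} (J*J≤meet f e v)) ⟩
          X f * (J f v * meet f e)         ∎

      -- Split the count by the vertex u of e at which an edge through v meets e. Each u other than
      -- v accounts for at most one edge by linearity. The term u = v, present only if v lies in e,
      -- is d v and is exactly what `lost` subtracts.
      lost≤k : ∀ e v → lost e v ≤ + k
      lost≤k e v = ≤-from-difference _
        (0≤difference (∑-mono-except {f = λ u → J e u * a u} {g = J e} v bound) ⊕ 0≤J e v)
        (begin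
          + k                                       ≡⟨ sym (uniform e) ⟩
          ∑ (J e)                                   ≡⟨ expand (∑ (J e)) A (J e v) (J e v * a v) ⟩
          A - J e v * a v + D                       ≡⟨ cong₂ (λ s b → s - J e v * b + D) (sym (lost-through e v)) a[v]≡d ⟩
          lost e v + D                              ∎)
        where
        open ≡-Reasoning
        a : Fin n → ℤ
        a u = ∑ λ f → X f * (J f u * J f v)
        a[v]≡d : a v ≡ d v
        a[v]≡d = ∑-cong λ f → cong (X f *_) (⟦⟧-idem (I f v))
        A D : ℤ
        A = ∑ λ u → J e u * a u
        D = ∑ (J e) + J e v * a v - (A + J e v) + J e v
        expand : ∀ U s j b → U ≡ s - b + (U + b - (s + j) + j)
        expand = solve-∀
        bound : ∀ u → u ≢ v → J e u * a u ≤ J e u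
        bound u u≢v = subst (J e u * a u ≤_) (*-identityʳ (J e u))
          (*-monoˡ-≤-nonNeg (J e u) {{nonNegative (0≤J e u)}} (codegree≤1 x u v u≢v))

      -- At most k Δ active edges are counted as meeting e, and each spreads its loss over k
      -- vertices.
      ∑-lost≤ : ∀ e → ∑ (lost e) ≤ + k * + k * Δ
      ∑-lost≤ e = begin
        ∑ (lost e)                                      ≤⟨ ∑-mono drop ⟩
        ∑ (λ v → ∑ λ f → X f * (J f v * meet f e))      ≡⟨ ∑-swap _ ⟩
        ∑ (λ f → ∑ λ v → X f * (J f v * meet f e))
          ≡⟨ ∑-cong (λ f → trans (∑-cong λ v → regroup (X f) (J f v) (meet f e))
               (trans (∑-*³ (X f) (meet f e) (J f)) (trans (cong (λ s → X f * (meet f e * s)) (uniform f))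
                 (regroup′ (X f) (meet f e) (+ k))))) ⟩
        ∑ (λ f → + k * (X f * meet f e))                ≡⟨ ∑-* (+ k) _ ⟩
        + k * ∑ (λ f → X f * meet f e)                  ≡⟨ cong (+ k *_) (double-count x (J e)) ⟩
        + k * ∑ (λ v → d v * J e v)
          ≤⟨ *-monoˡ-≤-nonNeg (+ k) (∑-mono λ v → *-monoʳ-≤-nonNeg (J e v) {{nonNegative (0≤J e v)}} (deg≤Δ v)) ⟩
        + k * ∑ (λ v → Δ * J e v)                       ≡⟨ cong (+ k *_) (trans (∑-* Δ (J e)) (cong (Δ *_) (uniform e))) ⟩
        + k * (Δ * + k)                                 ≡⟨ regroup″ (+ k) Δ ⟩
        + k * + k * Δ                                   ∎
        where
        open ≤-Reasoning
        regroup : ∀ x a b → x * (a * b) ≡ x * (b * a)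
        regroup = solve-∀
        regroup′ : ∀ x a k → x * (a * k) ≡ k * (x * a)
        regroup′ = solve-∀
        regroup″ : ∀ k Δ → k * (Δ * k) ≡ k * k * Δ
        regroup″ = solve-∀
        drop : ∀ v → lost e v ≤ ∑ (λ f → X f * (J f v * meet f e))
        drop v = ≤-from-difference _ (0≤J e v ⊛ 0≤deg x v) (restore _ _)
          where
          restore : ∀ s b → s ≡ (s - b) + b
          restore = solve-∀

      -- Since 0 ≤ `lost` ≤ k, its square is at most k times itself, so the sum of squares stays
      -- linear in Δ. The mixed product of prediction and loss enters with a negative sign and is
      -- dropped.
      ∑-w² : ∀ e → ∑ (λ v → w e v * w e v) ≤ R * R * m + q * q * (m * m) * (+ k * (+ k * + k * Δ))
      ∑-w² e = begin
        ∑ (λ v → w e v * w e v)                                       ≤⟨ ∑-mono pointwise ⟩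
        ∑ (λ v → R * R * Y v + q * q * (m * m) * (+ k * lost e v))    ≡⟨ ∑-linear (R * R) (q * q * (m * m)) _ _ ⟩
        R * R * m + q * q * (m * m) * ∑ (λ v → + k * lost e v)
          ≡⟨ cong (λ s → R * R * m + q * q * (m * m) * s) (∑-* (+ k) (lost e)) ⟩
        R * R * m + q * q * (m * m) * (+ k * ∑ (lost e))
          ≤⟨ +-monoʳ-≤ (R * R * m) (*-monoˡ-≤-nonNeg (q * q * (m * m)) {{nonNegative (0≤square q ⊛ 0≤square m)}}
               (*-monoˡ-≤-nonNeg (+ k) (∑-lost≤ e))) ⟩
        R * R * m + q * q * (m * m) * (+ k * (+ k * + k * Δ))         ∎
        where
        open ≤-Reasoning
        expand : ∀ R Y c b k → R * R * Y + b * b * (k * c) ≡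
          (R * Y - b * c) * (R * Y - b * c) +
          (R * R * (Y - Y * Y) + + 2 * ((R * Y) * (b * c)) + b * b * (c * (k - c)))
        expand = solve-∀
        pointwise : ∀ v → w e v * w e v ≤ R * R * Y v + q * q * (m * m) * (+ k * lost e v)
        pointwise v = ≤-from-difference _
          (0≤square R ⊛ 0≤difference (≤-reflexive (⟦⟧-idem (y v)))
            ⊕ 0≤+ {2} ⊛ ((0≤R ⊛ 0≤⟦⟧ (y v)) ⊛ ((0≤q ⊛ 0≤m) ⊛ 0≤lost e v))
            ⊕ 0≤square (q * m) ⊛ (0≤lost e v ⊛ 0≤difference (lost≤k e v)))
          (trans (cong (λ b → R * R * Y v + b * (+ k * lost e v)) (regroup q m))
            (expand R (Y v) (lost e v) (q * m) (+ k)))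
          where
          regroup : ∀ q m → q * q * (m * m) ≡ (q * m) * (q * m)
          regroup = solve-∀

      ∑-G : ∑ (λ e → X e * G e) ≤
        E * (m * m * V) + + 2 * m * (m * Δ * V) + E * (R * R * m + q * q * (m * m) * (+ k * (+ k * + k * Δ)))
      ∑-G = begin
        ∑ (λ e → X e * G e)
          ≡⟨ ∑-cong (λ e → trans (cong (X e *_) (∑-square-+ m δ (w e)))
               (distribute (X e) (m * m * V) (+ 2 * m) _ _)) ⟩
        ∑ (λ e → m * m * V * X e + 1ℤ * (+ 2 * m * (X e * ∑ (λ v → δ v * w e v))
          + 1ℤ * (X e * ∑ (λ v → w e v * w e v))))
          ≡⟨ trans (∑-linear (m * m * V) 1ℤ _ _)
               (cong (λ s → m * m * V * E + 1ℤ * s) (∑-linear (+ 2 * m) 1ℤ _ _)) ⟩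
        m * m * V * E + 1ℤ * (+ 2 * m * Λ + 1ℤ * ∑ (λ e → X e * ∑ (λ v → w e v * w e v)))
          ≤⟨ ≤-from-difference _
               ((0≤+ {2} ⊛ 0≤m) ⊛ 0≤difference Λ≤ ⊕ 0≤difference noise)
               (collect (m * m * V) E (+ 2 * m) Λ (m * Δ * V) _ c) ⟩
        E * (m * m * V) + + 2 * m * (m * Δ * V) + E * c ∎
        where
        open ≤-Reasoning
        c : ℤ
        c = R * R * m + q * q * (m * m) * (+ k * (+ k * + k * Δ))
        distribute : ∀ x a b s t → x * (a + (b * s + t)) ≡ a * x + 1ℤ * (b * (x * s) + 1ℤ * (x * t))
        distribute = solve-∀
        noise : ∑ (λ e → X e * ∑ (λ v → w e v * w e v)) ≤ c * E
        noise = ≤-trans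
          (∑-mono λ e → ≤-trans (*-monoˡ-≤-nonNeg (X e) {{nonNegative (0≤⟦⟧ (x e))}} (∑-w² e))
            (≤-reflexive (*-comm (X e) c)))
          (≤-reflexive (∑-* c X))
        collect : ∀ a E b Λ l s c → E * a + b * l + E * c ≡
          (a * E + 1ℤ * (b * Λ + 1ℤ * s)) + (b * (l - Λ) + (c * E - s))
        collect = solve-∀

-- Polynomial inequalities for the decay of the target and the growth of the variance.

module Estimates where

  open import Data.Integer.Base hiding (suc)
  open import Data.Integer.Properties
  open import Data.Integer.Tactic.RingSolver using (solve-∀)
  open import Data.Nat.Base as ℕ using (ℕ; zero; suc)
  open import Relation.Binary.PropositionalEquality
  open IntegerSums

  *-mono-≤-nonNeg : ∀ {a b c d} → 0ℤ ≤ a → a ≤ b → 0ℤ ≤ c → c ≤ d → a * c ≤ b * d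
  *-mono-≤-nonNeg {a} {b} {c} {d} 0≤a a≤b 0≤c c≤d = ≤-from-difference _
    (0≤a ⊛ 0≤difference c≤d ⊕ ≤-trans 0≤c c≤d ⊛ 0≤difference a≤b) (expand a b c d)
    where
    expand : ∀ a b c d → b * d ≡ a * c + (a * (d - c) + d * (b - a))
    expand = solve-∀

  0≤^ : ∀ {i} K → 0ℤ ≤ i → 0ℤ ≤ i ^ K
  0≤^ zero    0≤i = 0≤+
  0≤^ (suc K) 0≤i = 0≤i ⊛ 0≤^ K 0≤i

  0<^ : ∀ {i} K → 0ℤ < i → 0ℤ < i ^ K
  0<^ zero    0<i = +<+ (ℕ.s≤s ℕ.z≤n)
  0<^ (suc K) 0<i = 0<* 0<i (0<^ K 0<i)

  ^-monoˡ : ∀ {i j} K → 0ℤ ≤ i → i ≤ j → i ^ K ≤ j ^ K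
  ^-monoˡ zero    0≤i i≤j = ≤-refl
  ^-monoˡ (suc K) 0≤i i≤j = *-mono-≤-nonNeg 0≤i i≤j (0≤^ K 0≤i) (^-monoˡ K 0≤i i≤j)

  ^-distribʳ-* : ∀ i j K → (i * j) ^ K ≡ i ^ K * j ^ K
  ^-distribʳ-* i j zero    = refl
  ^-distribʳ-* i j (suc K) =
    trans (cong (i * j *_) (^-distribʳ-* i j K)) (regroup i j (i ^ K) (j ^ K))
    where
    regroup : ∀ i j a b → i * j * (a * b) ≡ i * a * (j * b)
    regroup = solve-∀

  -- Cleared of denominators: 1 + K / m ≤ (m / m₁) ^ K. It lets per-step factors of the form 1 + K /
  -- m telescope into a power of n / m.
  bernoulli : ∀ {m m₁} K → 0ℤ ≤ m₁ → m₁ + 1ℤ ≤ m → (m + + K) * m₁ ^ K ≤ m ^ K * m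
  bernoulli {m} zero    0≤m₁ m₁<m = ≤-reflexive (simplify m)
    where
    simplify : ∀ m → (m + 0ℤ) * 1ℤ ≡ 1ℤ * m
    simplify = solve-∀
  bernoulli {m} {m₁} (suc K) 0≤m₁ m₁<m = ≤-from-difference _
    (0≤m ⊛ 0≤difference (bernoulli K 0≤m₁ m₁<m)
      ⊕ 0≤^ K 0≤m₁ ⊛ ((0≤m ⊕ 0≤+ {suc K}) ⊛ 0≤difference m₁<m ⊕ 0≤+ {suc K}))
    (expand m m₁ (+ K) (m ^ K) (m₁ ^ K))
    where
    0≤m : 0ℤ ≤ m
    0≤m = ≤-trans (0≤m₁ ⊕ 0≤+ {1}) m₁<m
    expand : ∀ m m₁ K M M₁ → m * M * m ≡ (m + (1ℤ + K)) * (m₁ * M₁) +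
      (m * (M * m - (m + K) * M₁) + M₁ * ((m + (1ℤ + K)) * (m - (m₁ + 1ℤ)) + (1ℤ + K)))
    expand = solve-∀

  one-step : ∀ {k L D P q m E V G : ℤ} →
    0ℤ ≤ k → 1ℤ ≤ k → 0ℤ ≤ L → 0ℤ ≤ D → 0ℤ < P → 0ℤ < q → 0ℤ < E → 0ℤ ≤ V → D ≤ m →
    P ≤ q * D → q * D ≤ P * L → P * m ≤ + 2 * (k * (q * E)) →
    let R = k * (k - 1ℤ) * P; Δ = + 2 * k * D in
    E * G ≤ E * (m * m * V) + + 2 * m * (m * Δ * V)
      + E * (R * R * m + q * q * (m * m) * (k * (k * k * Δ))) →
    G ≤ m * m * V + + 8 * k * k * L * m * V + + 3 * (k * k * (k * k)) * D * (q * q * (m * m))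
  one-step {k} {L} {D} {P} {q} {m} {E} {V} {G} 0≤k 1≤k 0≤L 0≤D 0<P 0<q 0<E 0≤V D≤m P≤qD qD≤PL Pm≤ G≤ =
    *-cancelˡ-≤-positive 0<E (≤-trans G≤ (≤-from-difference _
      (0≤difference growth ⊕ <⇒≤ 0<E ⊛ 0≤difference noise)
      (collect E (m * m * V) (+ 2 * m * (m * (+ 2 * k * D) * V)) (+ 8 * k * k * L * m * V)
        (R * R * m) k D (q * q * (m * m)))))
    where
    R : ℤ
    R = k * (k - 1ℤ) * P
    0≤m : 0ℤ ≤ m
    0≤m = ≤-trans 0≤D D≤m
    0≤P : 0ℤ ≤ P
    0≤P = <⇒≤ 0<P
    growth : + 2 * m * (m * (+ 2 * k * D) * V) ≤ E * (+ 8 * k * k * L * m * V)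
    growth = *-cancelˡ-≤-positive 0<P (≤-from-difference _
      (0≤+ {4} ⊛ 0≤k ⊛ 0≤m ⊛ 0≤D ⊛ 0≤V ⊛ 0≤difference Pm≤
        ⊕ 0≤+ {8} ⊛ 0≤k ⊛ 0≤k ⊛ <⇒≤ 0<E ⊛ 0≤m ⊛ 0≤V ⊛ 0≤difference qD≤PL)
      (expand P E k L m V D q))
      where
      expand : ∀ P E k L m V D q → P * (E * (+ 8 * k * k * L * m * V)) ≡
        P * (+ 2 * m * (m * (+ 2 * k * D) * V)) +
        (+ 4 * k * m * D * V * (+ 2 * (k * (q * E)) - P * m)
          + + 8 * k * k * E * m * V * (P * L - q * D))
      expand = solve-∀
    noise : R * R * m ≤ k * k * (k * k) * D * (q * q * (m * m))
    noise = ≤-trans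
      (*-monoʳ-≤-nonNeg m {{nonNegative 0≤m}} (*-mono-≤-nonNeg 0≤R R≤ 0≤R R≤))
      (≤-from-difference _
        ((0≤square k ⊛ 0≤square k) ⊛ 0≤D ⊛ (0≤square q ⊛ 0≤m) ⊛ 0≤difference D≤m)
        (expand k q D m))
      where
      expand : ∀ k q D m → k * k * (k * k) * D * (q * q * (m * m)) ≡
        k * k * (q * D) * (k * k * (q * D)) * m + k * k * (k * k) * D * (q * q * m) * (m - D)
      expand = solve-∀
      0≤R : 0ℤ ≤ R
      0≤R = 0≤k ⊛ 0≤difference 1≤k ⊛ 0≤P
      R≤ : R ≤ k * k * (q * D)
      R≤ = ≤-from-difference _ (0≤square k ⊛ 0≤difference P≤qD ⊕ 0≤k ⊛ 0≤P) (expand′ k P (q * D))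
        where
        expand′ : ∀ k P b → k * k * b ≡ k * (k - 1ℤ) * P + (k * k * (b - P) + k * P)
        expand′ = solve-∀
    collect : ∀ E a b c r k D s →
      E * (a + c + + 3 * (k * k * (k * k)) * D * s) ≡
      E * a + b + E * (r + s * (k * (k * k * (+ 2 * k * D)))) +
      (E * c - b + E * (k * k * (k * k) * D * s - r))
    collect = solve-∀

  -- With M = m ^ K and M₁ = (m - k) ^ K: the factor 1 + B / m gained in one step
  -- and the additive noise C are absorbed by (m / (m - k)) ^ K.
  variance-decay : ∀ {m V V′ B C M M₁ N q : ℤ} →
    0ℤ < m → 0ℤ < M → 0ℤ ≤ M₁ → 0ℤ ≤ B → 0ℤ ≤ C →
    V′ ≤ m * m * V + B * m * V + C * (q * q * (m * m)) →
    V * M ≤ C * N * (q * q) → M * m ≤ N → (m + (1ℤ + B)) * M₁ ≤ M * m →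
    V′ * M₁ ≤ C * N * (q * m * (q * m))
  variance-decay {m} {V} {V′} {B} {C} {M} {M₁} {N} {q} 0<m 0<M 0≤M₁ 0≤B 0≤C V′≤ V≤ Mm≤N shrink =
    *-cancelˡ-≤-positive 0<M (≤-from-difference _
      (<⇒≤ 0<M ⊛ 0≤M₁ ⊛ 0≤difference V′≤
        ⊕ (0≤m ⊛ 0≤m ⊕ 0≤B ⊛ 0≤m) ⊛ 0≤M₁ ⊛ 0≤difference V≤
        ⊕ 0≤C ⊛ 0≤square q ⊛ 0≤m ⊛ 0≤M₁ ⊛ 0≤difference Mm≤N
        ⊕ 0≤C ⊛ 0≤N ⊛ 0≤square q ⊛ 0≤m ⊛ 0≤difference shrink)
      (expand m V V′ B C M M₁ N q))
    where
    0≤m : 0ℤ ≤ m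
    0≤m = <⇒≤ 0<m
    0≤N : 0ℤ ≤ N
    0≤N = ≤-trans (<⇒≤ 0<M ⊛ 0≤m) Mm≤N
    expand : ∀ m V V′ B C M M₁ N q → M * (C * N * (q * m * (q * m))) ≡ M * (V′ * M₁) +
      (M * M₁ * (m * m * V + B * m * V + C * (q * q * (m * m)) - V′)
      + (m * m + B * m) * M₁ * (C * N * (q * q) - V * M)
      + C * (q * q) * m * M₁ * (N - M * m)
      + C * N * (q * q) * m * (M * m - (m + (1ℤ + B)) * M₁))
    expand = solve-∀

  -- For m ≥ 2 k² the product (1 - k (k - 1) / m) (1 + 2 k² / m) is at least 1. So one decay step of
  -- the target costs at most the factor that `bernoulli` extracts from the exponent 2 k².
  target-decay : ∀ {k m q D P M M₁ N : ℤ} →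
    0ℤ ≤ k → 1ℤ ≤ k → 0ℤ < m → 0ℤ ≤ M → 0ℤ ≤ M₁ → 0ℤ ≤ q → 0ℤ ≤ D → + 2 * k * k ≤ m →
    q * D * M ≤ P * N → (m + + 2 * k * k) * M₁ ≤ M * m →
    q * m * D * M₁ ≤ P * (m - k * (k - 1ℤ)) * N
  target-decay {k} {m} {q} {D} {P} {M} {M₁} {N} 0≤k 1≤k 0<m 0≤M 0≤M₁ 0≤q 0≤D large lower shrink =
    *-cancelˡ-≤-positive 0<c (≤-from-difference _
      (0≤c ⊛ 0≤left ⊛ 0≤difference lower
        ⊕ 0≤q ⊛ 0≤D ⊛ 0≤M ⊛ (0≤square k ⊛ 0≤difference large ⊕ 0≤k ⊛ 0≤c)
        ⊕ 0≤q ⊛ 0≤D ⊛ <⇒≤ 0<m ⊛ 0≤difference shrink)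
      (expand k m q D P M M₁ N))
    where
    0<c : 0ℤ < m + + 2 * k * k
    0<c = +-mono-<-≤ 0<m (0≤+ {2} ⊛ 0≤k ⊛ 0≤k)
    0≤c : 0ℤ ≤ m + + 2 * k * k
    0≤c = <⇒≤ 0<c
    0≤left : 0ℤ ≤ m - k * (k - 1ℤ)
    0≤left = ≤-trans (0≤square k ⊕ 0≤k ⊕ 0≤difference large) (≤-reflexive (expand′ k m))
      where
      expand′ : ∀ k m → k * k + k + (m - + 2 * k * k) ≡ m - k * (k - 1ℤ)
      expand′ = solve-∀
    expand : ∀ k m q D P M M₁ N →
      (m + + 2 * k * k) * (P * (m - k * (k - 1ℤ)) * N) ≡
      (m + + 2 * k * k) * (q * m * D * M₁) +
      ((m + + 2 * k * k) * (m - k * (k - 1ℤ)) * (P * N - q * D * M)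
      + q * D * M * (k * k * (m - + 2 * k * k) + k * (m + + 2 * k * k))
      + q * D * m * (M * m - (m + + 2 * k * k) * M₁))
    expand = solve-∀

-- The residual system after one edge joins the matching.

module EdgeRemoval where

  open import Data.Bool.Base using (Bool; true; false; _∧_; not)
  open import Data.Bool.Properties using (∧-conicalˡ; ∧-identityʳ; ∧-zeroʳ)
  open import Data.Empty using (⊥-elim)
  open import Data.Fin.Base using (Fin)
  open import Data.Integer.Base hiding (suc)
  open import Data.Integer.Properties
  open import Data.Integer.Tactic.RingSolver using (solve-∀)
  open import Data.Nat.Base as ℕ using (ℕ)
  open import Relation.Binary.PropositionalEquality hiding (J)
  open import Relation.Nullary.Decidable using (yes; no; ⌊_⌋)
  open IntegerSums
  open LinearSystems
  open GreedyStep

  module Removal {N n k : ℕ} (L : LinearSystem N n k)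
    (x : Fin N → Bool) (y : Fin n → Bool) (q P : ℤ)
    (alive : ∀ e v → x e ≡ true → LinearSystem.I L e v ≡ true → y v ≡ true)
    (e : Fin N) (xe : x e ≡ true)
    where

    open LinearSystem L

    open Step L x y q P alive

    x′ : Fin N → Bool
    x′ f = x f ∧ ⌊ meet f e ≤? 0ℤ ⌋

    y′ : Fin n → Bool
    y′ v = y v ∧ not (I e v)

    -- The target degree is multiplied by 1 - k (k - 1) / m, the expected effect
    -- on the degrees of deleting a random edge of a regular system.
    q′ P′ : ℤ
    q′ = q * m
    P′ = P * (m - + k * (+ k - 1ℤ))

    x′⇒disjoint : ∀ f v → x′ f ≡ true → I f v ≡ true → I e v ≡ false
    x′⇒disjoint f v x′f fv with meet f e ≤? 0ℤ | I e v in ev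
    ... | _      | false = refl
    ... | no _   | true  with () ← trans (sym x′f) (∧-zeroʳ (x f))
    ... | yes le | true  = ⊥-elim (<-irrefl refl (<-≤-trans (+<+ (ℕ.s≤s ℕ.z≤n))
      (≤-trans (subst (_≤ meet f e) (cong₂ (λ a b → ⟦ a ⟧ * ⟦ b ⟧) fv ev) (J*J≤meet f e v)) le)))

    alive′ : ∀ f v → x′ f ≡ true → I f v ≡ true → y′ v ≡ true
    alive′ f v x′f fv = cong₂ (λ a b → a ∧ not b)
      (alive f v (∧-conicalˡ (x f) _ x′f) fv) (x′⇒disjoint f v x′f fv)

    module Next = Step L x′ y′ q′ P′ alive′

    ∑-Y′ : Next.m ≡ m - + k
    ∑-Y′ = trans (∑-cong pointwise) (trans (∑-sub Y (J e)) (cong (λ a → m - a) (uniform e)))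
      where
      pointwise : ∀ v → Next.Y v ≡ Y v - J e v
      pointwise v with I e v in ev
      ... | false = trans (cong ⟦_⟧ (∧-identityʳ (y v))) (sym (+-identityʳ (Y v)))
      ... | true  = trans (cong ⟦_⟧ (∧-zeroʳ (y v))) (cong (λ b → ⟦ b ⟧ - 1ℤ) (sym (alive e v xe ev)))

    deg′≤deg : ∀ v → Next.d v ≤ d v
    deg′≤deg v = ∑-mono λ f → *-monoʳ-≤-nonNeg (J f v) {{nonNegative (0≤J f v)}} (⟦∧⟧≤ (x f) _)
      where
      ⟦∧⟧≤ : ∀ a b → ⟦ a ∧ b ⟧ ≤ ⟦ a ⟧
      ⟦∧⟧≤ false b = ≤-refl
      ⟦∧⟧≤ true  b = ⟦⟧≤1 b

    -- An active edge f through v differs from e, which misses v, so `meet f e` is 0 or 1 and is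
    -- itself the indicator that f is deleted. The correction term in `lost` vanishes off e.
    deg′-outside : ∀ v → I e v ≡ false → Next.d v ≡ d v - lost e v
    deg′-outside v ev = begin
      Next.d v                                              ≡⟨ ∑-cong pointwise ⟩
      ∑ (λ f → X f * J f v - X f * (J f v * meet f e))      ≡⟨ ∑-sub _ _ ⟩
      d v - ∑ (λ f → X f * (J f v * meet f e))              ≡⟨ expand (d v) _ ⟩
      d v - (∑ (λ f → X f * (J f v * meet f e)) - 0ℤ * d v) ≡⟨ cong (λ b → d v - (∑ (λ f → X f * (J f v * meet f e)) - ⟦ b ⟧ * d v)) (sym ev) ⟩
      d v - lost e v                                        ∎
      where
      open ≡-Reasoning
      expand : ∀ d s → d - s ≡ d - (s - 0ℤ * d)
      expand = solve-∀
      pointwise : ∀ f → ⟦ x′ f ⟧ * J f v ≡ X f * J f v - X f * (J f v * meet f e)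
      pointwise f with x f | I f v in fv
      ... | false | _     = refl
      ... | true  | false = *-zeroʳ ⟦ ⌊ meet f e ≤? 0ℤ ⌋ ⟧
      ... | true  | true  with meet f e ≤? 0ℤ
      ...   | yes le = cong (λ s → 1ℤ - 1ℤ * (1ℤ * s)) (≤-antisym (0≤meet f e) le)
      ...   | no ≰   = cong (λ s → 1ℤ - 1ℤ * (1ℤ * s)) (≤-antisym
                         (i<j⇒suc[i]≤j (≰⇒> ≰)) (meet≤1 f e f≢e))
        where
        f≢e : f ≢ e
        f≢e refl with () ← trans (sym ev) fv

    -- Off e the two sides agree term by term, because the choice of `P′` makes the new deviation m
    -- δ + w. On e the new deviation is 0, since the vertex is dead, while `G e` has a square there.
    variance′≤ : Next.V ≤ G e
    variance′≤ = ∑-mono pointwise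
      where
      δ′-inside : ∀ v → I e v ≡ true → Next.δ v ≡ 0ℤ
      δ′-inside v ev = trans (sym (Next.δY≡δ v)) (trans (cong (λ b → Next.δ v * ⟦ b ⟧)
        (trans (cong (λ b → y v ∧ not b) ev) (∧-zeroʳ (y v)))) (*-zeroʳ (Next.δ v)))
      δ′-outside : ∀ v → I e v ≡ false → Next.δ v ≡ m * δ v + w e v
      δ′-outside v ev = trans
        (cong₂ (λ a b → q′ * a - P′ * ⟦ b ⟧) (deg′-outside v ev)
          (trans (cong (λ b → y v ∧ not b) ev) (∧-identityʳ (y v))))
        (expand q m P (+ k) (d v) (lost e v) (Y v))
        where
        expand : ∀ q m P k d l Y → q * m * (d - l) - P * (m - k * (k - 1ℤ)) * Y ≡
          m * (q * d - P * Y) + (k * (k - 1ℤ) * P * Y - q * m * l)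
        expand = solve-∀
      pointwise : ∀ v → Next.δ v * Next.δ v ≤ (m * δ v + w e v) * (m * δ v + w e v)
      pointwise v = by-cases (I e v) refl
        where
        by-cases : ∀ b → I e v ≡ b → Next.δ v * Next.δ v ≤ (m * δ v + w e v) * (m * δ v + w e v)
        by-cases true  ev = ≤-trans (≤-reflexive (cong (λ a → a * a) (δ′-inside v ev))) (0≤square (m * δ v + w e v))
        by-cases false ev = ≤-reflexive (cong (λ a → a * a) (δ′-outside v ev))

-- A nearly regular subsystem of degree about D as a local minimum.

module NearRegularSubgraph where

  open import Data.Bool.Base using (Bool; true; false; _∧_; not)
  open import Data.Bool.Properties using (∧-conicalˡ; ∧-conicalʳ; not-injective)
  open import Data.Fin.Base using (Fin; zero; suc)
  import Data.Fin.Properties as Finₚ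
  open import Data.Integer.Base hiding (suc)
  open import Data.Integer.Properties
  open import Data.Integer.Tactic.RingSolver using (solve-∀)
  open import Data.Nat.Base as ℕ using (ℕ; zero; suc)
  import Data.Nat.Properties as ℕₚ
  open import Data.Nat.Induction using (<-wellFounded)
  open import Data.Product.Base using (_,_; ∃-syntax)
  open import Data.Vec.Functional using (updateAt)
  open import Data.Vec.Functional.Properties using (updateAt-updates; updateAt-minimal)
  open import Function.Base using (_∘_)
  open import Induction.WellFounded using (Acc; acc)
  open import Relation.Binary.PropositionalEquality hiding (J)
  open import Relation.Nullary.Decidable using (yes; no)
  open IntegerSums
  open LinearSystems

  flipAt : ∀ {N} → Fin N → (Fin N → Bool) → Fin N → Bool
  flipAt e x = updateAt x e not

  local-minimum : ∀ {N} (f : (Fin N → Bool) → ℕ) → ∃[ x ] (∀ e → f x ℕ.≤ f (flipAt e x))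
  local-minimum {N} f = descend (λ _ → false) (<-wellFounded _)
    where
    descend : ∀ x → Acc ℕ._<_ (f x) → ∃[ x ] (∀ e → f x ℕ.≤ f (flipAt e x))
    descend x (acc smaller) with Finₚ.any? (λ e → f (flipAt e x) ℕₚ.<? f x)
    ... | yes (e , lt) = descend (flipAt e x) (smaller lt)
    ... | no none      = x , λ e → ℕₚ.≮⇒≥ λ lt → none (e , lt)

  argmax : ∀ {n} (f : Fin (suc n) → ℤ) → ∃[ v ] (∀ u → f u ≤ f v)
  argmax {zero}  f = zero , λ { zero → ≤-refl }
  argmax {suc n} f with argmax (f ∘ suc)
  ... | v , max with f zero ≤? f (suc v)
  ...   | yes ≤v = suc v , λ { zero → ≤v ; (suc u) → max u }
  ...   | no  ≰v = zero , λ { zero → ≤-refl ; (suc u) → ≤-trans (max u) (<⇒≤ (≰⇒> ≰v)) }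

  irregularity : ∀ {N n k} → LinearSystem N n k → ℤ → (Fin N → Bool) → ℤ
  irregularity L D x = ∑ λ v → (D - deg x v) * (D - deg x v)
    where open LinearSystem L

  -- Minimality under single flips is enough later, so descent on the natural number ∣Φ∣ suffices;
  -- as Φ is a sum of squares, the absolute value changes nothing.
  least-irregular : ∀ {N n k} (L : LinearSystem N n k) D →
    ∃[ x ] (∀ e → irregularity L D x ≤ irregularity L D (flipAt e x))
  least-irregular L D with local-minimum (λ x → ∣ irregularity L D x ∣)
  ... | x , minimal = x , λ e →
    subst₂ _≤_ (0≤i⇒+∣i∣≡i (0≤Φ x)) (0≤i⇒+∣i∣≡i (0≤Φ (flipAt e x))) (+≤+ (minimal e))
    where
    0≤Φ : ∀ x → 0ℤ ≤ irregularity L D x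
    0≤Φ x = 0≤∑ λ v → 0≤square (D - LinearSystem.deg L x v)

  module LocalMinimum {N n k : ℕ} (L : LinearSystem N n k)
    (1≤k : 1 ℕ.≤ k) (D : ℤ) (1≤D : 1ℤ ≤ D) (x : Fin N → Bool)
    (Φ-minimal : ∀ e → irregularity L D x ≤ irregularity L D (flipAt e x))
    (dense : ∀ v → + n + + k * D ≤ + k * ∑ (λ e → LinearSystem.J L e v))
    where

    open LinearSystem L

    κ ν : ℤ
    κ = + k
    ν = + n

    0≤κ : 0ℤ ≤ κ
    0≤κ = 0≤+

    0≤D : 0ℤ ≤ D
    0≤D = ≤-trans 0≤+ 1≤D

    Φ : (Fin N → Bool) → ℤ
    Φ = irregularity L D

    r : Fin n → ℤ
    r v = D - deg x v

    edge-sum : Fin N → ℤ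
    edge-sum e = ∑ λ v → J e v * r v

    r≤D : ∀ v → r v ≤ D
    r≤D v = ≤-from-difference _ (0≤deg x v) (restore D (deg x v))
      where
      restore : ∀ D d → D ≡ D - d + d
      restore = solve-∀

    deg-flip : ∀ e v → deg (flipAt e x) v ≡ deg x v + (⟦ not (x e) ⟧ - ⟦ x e ⟧) * J e v
    deg-flip e v = trans (isolate (deg (flipAt e x) v) (⟦ x e ⟧ * J e v))
      (trans (cong (_- ⟦ x e ⟧ * J e v) (trans
        (∑-update e λ f f≢e → cong (λ b → ⟦ b ⟧ * J f v) (updateAt-minimal f e x f≢e))
        (cong (λ b → deg x v + ⟦ b ⟧ * J e v) (updateAt-updates e x))))
        (collect (deg x v) ⟦ not (x e) ⟧ ⟦ x e ⟧ (J e v)))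
      where
      isolate : ∀ a b → a ≡ a + b - b
      isolate = solve-∀
      collect : ∀ d a b j → d + a * j - b * j ≡ d + (a - b) * j
      collect = solve-∀

    -- The sign σ is 1 when e is added and -1 when it is deleted. Each r on e decreases by σ, and
    -- the squares expand with k terms σ².
    Φ-flip : ∀ e → let σ = ⟦ not (x e) ⟧ - ⟦ x e ⟧ in
      Φ (flipAt e x) ≡ Φ x - + 2 * σ * edge-sum e + σ * σ * κ
    Φ-flip e = begin
      Φ (flipAt e x)
        ≡⟨ ∑-cong (λ v → cong (λ d → (D - d) * (D - d)) (deg-flip e v)) ⟩
      ∑ (λ v → (D - (deg x v + σ * J e v)) * (D - (deg x v + σ * J e v)))
        ≡⟨ ∑-cong (λ v → cong (λ a → a * a) (regroup D (deg x v) σ (J e v))) ⟩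
      ∑ (λ v → (1ℤ * r v + - σ * J e v) * (1ℤ * r v + - σ * J e v))
        ≡⟨ ∑-square-+ 1ℤ r (λ v → - σ * J e v) ⟩
      1ℤ * 1ℤ * Φ x + (+ 2 * 1ℤ * ∑ (λ v → r v * (- σ * J e v)) + ∑ (λ v → (- σ * J e v) * (- σ * J e v)))
        ≡⟨ cong₂ (λ a b → 1ℤ * 1ℤ * Φ x + (+ 2 * 1ℤ * a + b)) mixed squared ⟩
      1ℤ * 1ℤ * Φ x + (+ 2 * 1ℤ * (- σ * edge-sum e) + σ * σ * κ)
        ≡⟨ collect (Φ x) σ (edge-sum e) κ ⟩
      Φ x - + 2 * σ * edge-sum e + σ * σ * κ ∎
      where
      open ≡-Reasoning
      σ : ℤ
      σ = ⟦ not (x e) ⟧ - ⟦ x e ⟧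
      regroup : ∀ D d s j → D - (d + s * j) ≡ 1ℤ * (D - d) + - s * j
      regroup = solve-∀
      swap : ∀ r s j → r * (- s * j) ≡ - s * (j * r)
      swap = solve-∀
      swap′ : ∀ s j → (- s * j) * (- s * j) ≡ s * s * (j * j)
      swap′ = solve-∀
      collect : ∀ a s b k → 1ℤ * 1ℤ * a + (+ 2 * 1ℤ * (- s * b) + s * s * k) ≡ a - + 2 * s * b + s * s * k
      collect = solve-∀
      mixed : ∑ (λ v → r v * (- σ * J e v)) ≡ - σ * edge-sum e
      mixed = trans (∑-cong λ v → swap (r v) σ (J e v)) (∑-* (- σ) _)
      squared : ∑ (λ v → (- σ * J e v) * (- σ * J e v)) ≡ σ * σ * κ
      squared = trans (∑-cong λ v → trans (swap′ σ (J e v)) (cong (σ * σ *_) (⟦⟧-idem (I e v))))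
        (trans (∑-* (σ * σ) (J e)) (cong (σ * σ *_) (uniform e)))

    signed : ∀ e → + 2 * (⟦ not (x e) ⟧ - ⟦ x e ⟧) * edge-sum e ≤
      (⟦ not (x e) ⟧ - ⟦ x e ⟧) * (⟦ not (x e) ⟧ - ⟦ x e ⟧) * κ
    signed e = ≤-from-difference _ (0≤difference (≤-trans (Φ-minimal e) (≤-reflexive (Φ-flip e))))
      (cancel (Φ x) (+ 2 * σ * edge-sum e) (σ * σ * κ))
      where
      σ : ℤ
      σ = ⟦ not (x e) ⟧ - ⟦ x e ⟧
      cancel : ∀ a s b → b ≡ s + (a - s + b - a)
      cancel = solve-∀

    signed-at : ∀ e {b} → x e ≡ b →
      + 2 * (⟦ not b ⟧ - ⟦ b ⟧) * edge-sum e ≤ (⟦ not b ⟧ - ⟦ b ⟧) * (⟦ not b ⟧ - ⟦ b ⟧) * κ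
    signed-at e refl = signed e

    unselected : ∀ e → not (x e) ≡ true → + 2 * edge-sum e ≤ κ
    unselected e xe = subst (+ 2 * edge-sum e ≤_) (*-identityˡ κ) (signed-at e (not-injective xe))

    selected : ∀ e → x e ≡ true → - κ ≤ + 2 * edge-sum e
    selected e xe = ≤-from-difference _ (0≤difference (signed-at e xe)) (cancel (edge-sum e) κ)
      where
      cancel : ∀ a k → + 2 * a ≡ - k + (-1ℤ * -1ℤ * k - + 2 * -1ℤ * a)
      cancel = solve-∀

    -- A selected edge through u has `edge-sum` at least - k / 2, while its other k - 1 vertices
    -- contribute at most D each. So r u cannot be too negative: deg u ≤ k D + k / 2 ≤ 2 k D.
    deg≤2κD : ∀ u → deg x u ≤ + 2 * κ * D
    deg≤2κD u with deg x u ≤? 0ℤ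
    ... | yes le = ≤-trans le (0≤+ {2} ⊛ 0≤κ ⊛ 0≤D)
    -- With the zero function, `average` merely extracts a selected edge through u from the fact
    -- that their number is positive.
    ... | no  ≰  with average (λ e → x e ∧ I e u) (λ _ → 0ℤ) 0ℤ
                     (subst (0ℤ <_) (∑-cong λ e → sym (⟦∧⟧ (x e) (I e u))) (≰⇒> ≰))
                     (≤-reflexive (trans (∑-cong λ e → *-zeroʳ ⟦ x e ∧ I e u ⟧) (∑-zero N)))
    ...   | e , both , _ = *-cancelˡ-≤-positive {+ 2} (+<+ (ℕ.s≤s ℕ.z≤n)) (≤-from-difference _
            (0≤difference (selected e (∧-conicalˡ _ _ both)) ⊕ 0≤+ {2} ⊛ 0≤difference others
              ⊕ 0≤κ ⊛ (0≤difference 1≤D ⊕ 0≤D))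
            (expand κ D (deg x u) (edge-sum e)))
      where
      Jeu≡1 : J e u ≡ 1ℤ
      Jeu≡1 = cong ⟦_⟧ (∧-conicalʳ (x e) _ both)
      others : edge-sum e + D ≤ D * κ + (D - deg x u)
      others = subst₂ _≤_
        (cong (_+_ (edge-sum e)) (trans (cong (D *_) Jeu≡1) (*-identityʳ D)))
        (cong₂ _+_ (trans (∑-* D (J e)) (cong (D *_) (uniform e))) (trans (cong (_* r u) Jeu≡1) (*-identityˡ (r u))))
        (∑-mono-except {f = λ v → J e v * r v} {g = λ v → D * J e v} u λ v _ →
          ≤-trans (*-monoˡ-≤-nonNeg (J e v) {{nonNegative (0≤J e v)}} (r≤D v)) (≤-reflexive (*-comm (J e v) D)))
      expand : ∀ k D d s → + 2 * (+ 2 * k * D) ≡ + 2 * d +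
        (+ 2 * s - - k + + 2 * (D * k + (D - d) - (s + D)) + k * (D - 1ℤ + D))
      expand = solve-∀

    module AtMaximum (v : Fin n) (max : ∀ u → r u ≤ r v) (1≤r : 1ℤ ≤ r v) where

      x̄ : Fin N → Bool
      x̄ e = not (x e)

      -- The number of unselected edges through both u and v: at most 1 for u ≢ v by linearity, and
      -- b̂ for u = v. These are the weights with which the local conditions at v are combined into
      -- a bound for the whole sum of r.
      b : Fin n → ℤ
      b u = ∑ λ e → ⟦ x̄ e ⟧ * (J e u * J e v)

      b̂ : ℤ
      b̂ = deg x̄ v

      through : ∀ (g : Fin n → ℤ) → ∑ (λ u → b u * g u) ≡ ∑ (λ e → ⟦ x̄ e ⟧ * (J e v * ∑ (λ u → J e u * g u)))
      through g = begin
        ∑ (λ u → b u * g u)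
          ≡⟨ ∑-cong (λ u → trans (*-comm (b u) (g u)) (sym (∑-* (g u) _))) ⟩
        ∑ (λ u → ∑ λ e → g u * (⟦ x̄ e ⟧ * (J e u * J e v)))
          ≡⟨ ∑-swap _ ⟩
        ∑ (λ e → ∑ λ u → g u * (⟦ x̄ e ⟧ * (J e u * J e v)))
          ≡⟨ ∑-cong (λ e → trans (∑-cong λ u → regroup (g u) ⟦ x̄ e ⟧ (J e u) (J e v)) (∑-*³ ⟦ x̄ e ⟧ (J e v) _)) ⟩
        ∑ (λ e → ⟦ x̄ e ⟧ * (J e v * ∑ (λ u → J e u * g u))) ∎
        where
        open ≡-Reasoning
        regroup : ∀ g x a c → g * (x * (a * c)) ≡ x * (c * (a * g))
        regroup = solve-∀

      ∑-b : ∑ b ≡ κ * b̂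
      ∑-b = begin
        ∑ b                                    ≡⟨ ∑-cong (λ u → sym (*-identityʳ (b u))) ⟩
        ∑ (λ u → b u * 1ℤ)                     ≡⟨ through (λ _ → 1ℤ) ⟩
        ∑ (λ e → ⟦ x̄ e ⟧ * (J e v * ∑ (λ u → J e u * 1ℤ)))
          ≡⟨ ∑-cong (λ e → trans (cong (λ s → ⟦ x̄ e ⟧ * (J e v * s))
               (trans (∑-cong λ u → *-identityʳ (J e u)) (uniform e))) (regroup ⟦ x̄ e ⟧ (J e v) κ)) ⟩
        ∑ (λ e → κ * (⟦ x̄ e ⟧ * J e v))        ≡⟨ ∑-* κ _ ⟩
        κ * b̂                                  ∎
        where
        open ≡-Reasoning
        regroup : ∀ x j k → x * (j * k) ≡ k * (x * j)
        regroup = solve-∀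

      ∑-br : + 2 * ∑ (λ u → b u * r u) ≤ κ * b̂
      ∑-br = begin
        + 2 * ∑ (λ u → b u * r u)                          ≡⟨ cong (+ 2 *_) (through r) ⟩
        + 2 * ∑ (λ e → ⟦ x̄ e ⟧ * (J e v * edge-sum e))     ≡⟨ sym (∑-* (+ 2) _) ⟩
        ∑ (λ e → + 2 * (⟦ x̄ e ⟧ * (J e v * edge-sum e)))   ≤⟨ ∑-mono pointwise ⟩
        ∑ (λ e → κ * (⟦ x̄ e ⟧ * J e v))                    ≡⟨ ∑-* κ _ ⟩
        κ * b̂                                              ∎
        where
        open ≤-Reasoning
        regroup : ∀ x j s → + 2 * (x * (j * s)) ≡ x * (j * (+ 2 * s))
        regroup = solve-∀
        regroup′ : ∀ x j k → x * (j * k) ≡ k * (x * j)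
        regroup′ = solve-∀
        pointwise : ∀ e → + 2 * (⟦ x̄ e ⟧ * (J e v * edge-sum e)) ≤ κ * (⟦ x̄ e ⟧ * J e v)
        pointwise e = begin
          + 2 * (⟦ x̄ e ⟧ * (J e v * edge-sum e))    ≡⟨ regroup ⟦ x̄ e ⟧ (J e v) (edge-sum e) ⟩
          ⟦ x̄ e ⟧ * (J e v * (+ 2 * edge-sum e))
            ≤⟨ ⟦⟧*-monoˡ (x̄ e) (λ x̄e → *-monoˡ-≤-nonNeg (J e v) {{nonNegative (0≤J e v)}} (unselected e x̄e)) ⟩
          ⟦ x̄ e ⟧ * (J e v * κ)                     ≡⟨ regroup′ ⟦ x̄ e ⟧ (J e v) κ ⟩
          κ * (⟦ x̄ e ⟧ * J e v)                     ∎

      -- (1 - b u) (r v - r u) ≥ 0: both factors are nonnegative for u ≢ v, and the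
      -- second one vanishes for u = v.
      ∑-r≤∑-br : ∑ r ≤ ∑ (λ u → b u * r u) + r v * (ν - κ * b̂)
      ∑-r≤∑-br = begin
        ∑ r                                              ≤⟨ ∑-mono pointwise ⟩
        ∑ (λ u → b u * r u + r v * (1ℤ - b u))           ≡⟨ ∑-+ _ _ ⟩
        ∑ (λ u → b u * r u) + ∑ (λ u → r v * (1ℤ - b u))
          ≡⟨ cong (_+_ (∑ (λ u → b u * r u))) (trans (∑-* (r v) _)
               (cong (r v *_) (trans (∑-sub _ b) (cong₂ _-_ (∑-one n) ∑-b)))) ⟩
        ∑ (λ u → b u * r u) + r v * (ν - κ * b̂)          ∎
        where
        open ≤-Reasoning
        expand : ∀ b r ρ → b * r + ρ * (1ℤ - b) ≡ r + (1ℤ - b) * (ρ - r)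
        expand = solve-∀
        product : ∀ u → 0ℤ ≤ (1ℤ - b u) * (r v - r u)
        product u with u Finₚ.≟ v
        ... | yes refl = ≤-reflexive (sym (trans (cong ((1ℤ - b u) *_) (+-inverseʳ (r u))) (*-zeroʳ (1ℤ - b u))))
        ... | no  u≢v  = 0≤difference (codegree≤1 x̄ u v u≢v) ⊛ 0≤difference (max u)
        pointwise : ∀ u → r u ≤ b u * r u + r v * (1ℤ - b u)
        pointwise u = ≤-from-difference _ (product u) (expand (b u) (r u) (r v))

      -- Here the surplus D in the minimum degree is spent: since r v > 0, fewer than D edges at v
      -- are selected, so the unselected ones still number at least n / k.
      ν≤κb̂ : ν ≤ κ * b̂
      ν≤κb̂ = ≤-from-difference _
        (0≤difference (dense v) ⊕ 0≤κ ⊛ (≤-trans 0≤+ 1≤r))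
        (trans (cong (κ *_) complement) (expand κ ν (∑ λ e → J e v) D (deg x v)))
        where
        ⟦not⟧ : ∀ c → ⟦ not c ⟧ ≡ 1ℤ - ⟦ c ⟧
        ⟦not⟧ false = refl
        ⟦not⟧ true  = refl
        distribute : ∀ a j → (1ℤ - a) * j ≡ j - a * j
        distribute = solve-∀
        complement : b̂ ≡ ∑ (λ e → J e v) - deg x v
        complement = trans
          (∑-cong λ e → trans (cong (_* J e v) (⟦not⟧ (x e))) (distribute ⟦ x e ⟧ (J e v)))
          (∑-sub _ _)
        expand : ∀ k ν s D d → k * (s - d) ≡ ν + (k * s - (ν + k * D) + k * (D - d))
        expand = solve-∀

      -- Combining the two previous sums gives 2 ∑ r ≤ κ b̂ + 2 r v (ν - κ b̂) = ν - (2 r v - 1) (κ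
      -- b̂ - ν). Both factors of the last product are nonnegative, the first because r v ≥ 1.
      2∑r≤ν : + 2 * ∑ r ≤ ν
      2∑r≤ν = ≤-from-difference _
        (0≤+ {2} ⊛ 0≤difference ∑-r≤∑-br ⊕ 0≤difference ∑-br
          ⊕ (0≤+ {2} ⊛ 0≤difference 1≤r ⊕ 0≤+ {1}) ⊛ 0≤difference ν≤κb̂)
        (expand (∑ r) ν (∑ (λ u → b u * r u)) (r v) (κ * b̂))
        where
        expand : ∀ s ν t ρ c → ν ≡ + 2 * s +
          (+ 2 * (t + ρ * (ν - c) - s) + (c - + 2 * t) + (+ 2 * (ρ - 1ℤ) + 1ℤ) * (c - ν))
        expand = solve-∀

    2∑r≤ν : 0 ℕ.< n → + 2 * ∑ r ≤ ν
    2∑r≤ν 0<n = by-maximum (maximum 0<n r)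
      where
      maximum : ∀ {n} → 0 ℕ.< n → (f : Fin n → ℤ) → ∃[ v ] (∀ u → f u ≤ f v)
      maximum {suc n} _ f = argmax f
      by-maximum : ∃[ v ] (∀ u → r u ≤ r v) → + 2 * ∑ r ≤ ν
      by-maximum (v , max) with r v ≤? 0ℤ
      ... | yes r≤0 = ≤-trans (*-monoˡ-≤-nonNeg (+ 2) (≤-trans (∑-mono λ u → ≤-trans (max u) r≤0)
                        (≤-reflexive (∑-zero n)))) 0≤+
      ... | no r≰0  = AtMaximum.2∑r≤ν v max (i<j⇒suc[i]≤j (≰⇒> r≰0))

    -- Summing `selected` over the chosen edges gives D ∑ r - Φ ≥ - (D ν - ∑ r) / 2, that is Φ ≤ (D
    -- - 1/2) ∑ r + D ν / 2. Now insert ∑ r ≤ ν / 2.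
    Φ≤Dν : 0 ℕ.< n → Φ x ≤ D * ν
    Φ≤Dν 0<n = *-cancelˡ-≤-positive {+ 4} (+<+ (ℕ.s≤s ℕ.z≤n)) (≤-from-difference _
      (0≤+ {2} ⊛ 0≤difference correlation
        ⊕ (0≤+ {2} ⊛ 0≤difference 1≤D ⊕ 0≤+ {1}) ⊛ 0≤difference (2∑r≤ν 0<n) ⊕ 0≤+ {n})
      (expand D ν (Φ x) (∑ r)))
      where
      open ≤-Reasoning
      expand : ∀ D ν Φ s → + 4 * (D * ν) ≡ + 4 * Φ +
        (+ 2 * (+ 2 * (D * s - Φ) - - (D * ν - s)) + (+ 2 * (D - 1ℤ) + 1ℤ) * (ν - + 2 * s) + ν)
      expand = solve-∀
      ∑-dr : ∑ (λ v → deg x v * r v) ≡ D * ∑ r - Φ x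
      ∑-dr = trans (∑-cong λ v → pointwise D (deg x v)) (trans (∑-sub _ _) (cong (_- Φ x) (∑-* D r)))
        where
        pointwise : ∀ D d → d * (D - d) ≡ D * (D - d) - (D - d) * (D - d)
        pointwise = solve-∀
      ∑-d : κ * ∑ (λ e → ⟦ x e ⟧) ≡ D * ν - ∑ r
      ∑-d = trans (sym (∑-deg x)) (trans (∑-cong λ v → pointwise D (deg x v))
        (trans (∑-sub _ r) (cong (_- ∑ r) (trans (∑-* D _) (cong (D *_) (∑-one n))))))
        where
        pointwise : ∀ D d → d ≡ D * 1ℤ - (D - d)
        pointwise = solve-∀
      correlation : - (D * ν - ∑ r) ≤ + 2 * (D * ∑ r - Φ x)
      correlation = begin
        - (D * ν - ∑ r)                              ≡⟨ cong -_ (sym ∑-d) ⟩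
        - (κ * ∑ (λ e → ⟦ x e ⟧))                    ≡⟨ neg-distribˡ-* κ _ ⟩
        - κ * ∑ (λ e → ⟦ x e ⟧)                      ≡⟨ sym (∑-* (- κ) _) ⟩
        ∑ (λ e → - κ * ⟦ x e ⟧)                      ≤⟨ ∑-mono pointwise ⟩
        ∑ (λ e → + 2 * (⟦ x e ⟧ * edge-sum e))       ≡⟨ ∑-* (+ 2) _ ⟩
        + 2 * ∑ (λ e → ⟦ x e ⟧ * edge-sum e)         ≡⟨ cong (+ 2 *_) (trans (double-count x r) ∑-dr) ⟩
        + 2 * (D * ∑ r - Φ x)                        ∎
        where
        swap : ∀ a s → a * (+ 2 * s) ≡ + 2 * (a * s)
        swap = solve-∀
        pointwise : ∀ e → - κ * ⟦ x e ⟧ ≤ + 2 * (⟦ x e ⟧ * edge-sum e)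
        pointwise e = begin
          - κ * ⟦ x e ⟧                  ≡⟨ *-comm (- κ) ⟦ x e ⟧ ⟩
          ⟦ x e ⟧ * - κ                  ≤⟨ ⟦⟧*-monoˡ (x e) (selected e) ⟩
          ⟦ x e ⟧ * (+ 2 * edge-sum e)   ≡⟨ swap ⟦ x e ⟧ (edge-sum e) ⟩
          + 2 * (⟦ x e ⟧ * edge-sum e)   ∎

-- The greedy matching and its invariants.

module GreedyMatching where

  open import Data.Bool.Base using (Bool; true; false; _∧_; not)
  open import Data.Bool.Properties using (∧-zeroʳ; ∧-identityʳ)
  open import Data.Empty using (⊥-elim)
  open import Data.Fin.Base using (Fin)
  open import Data.Integer.Base hiding (suc)
  open import Data.Integer.Properties
  open import Data.Integer.Tactic.RingSolver using (solve-∀)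
  open import Data.List.Base using (List; []; _∷_)
  open import Data.List.Relation.Unary.All as All using (All; []; _∷_)
  open import Data.List.Relation.Unary.AllPairs using (AllPairs; []; _∷_)
  open import Data.List.Relation.Unary.Any using (Any; here; there)
  open import Data.Nat.Base as ℕ using (ℕ; zero; suc)
  open import Data.Product.Base using (_,_; Σ-syntax)
  open import Relation.Binary.PropositionalEquality hiding (J)
  open import Relation.Nullary.Decidable using (yes; no)
  open IntegerSums
  open LinearSystems
  open GreedyStep
  open EdgeRemoval
  open Estimates

  module Greedy {N n k : ℕ} (L : LinearSystem N n k)
    (g K₁ K : ℕ) (D : ℤ) (1≤k : 1 ℕ.≤ k) (1≤g : 1 ℕ.≤ g) (0<D : 0ℤ < D)
    (K₁≡ : + K₁ ≡ + 2 * + k * + k)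
    (K≡ : + K ≡ 1ℤ + + 8 * + k * + k * (+ g) ^ K₁)
    (D≡ : D ≡ + 4 * (+ 3 * (+ k * + k * (+ k * + k))) * ((+ g) ^ K * + g) * ((+ g) ^ K₁ * (+ g) ^ K₁))
    (large : + g * (D + + 2 * + k * + k) ≤ + n)
    where

    open LinearSystem L

    -- While m ≥ n / g, the target degree P / q stays above D / Γ.
    κ γ ν Γ c C Δ : ℤ
    κ = + k
    γ = + g
    ν = + n
    Γ = γ ^ K₁
    c = + 3 * (κ * κ * (κ * κ))
    C = c * D
    Δ = + 2 * κ * D

    0≤κ : 0ℤ ≤ κ
    0≤κ = 0≤+

    0<γ : 0ℤ < γ
    0<γ = +<+ 1≤g

    0≤D : 0ℤ ≤ D
    0≤D = <⇒≤ 0<D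

    0<Γ : 0ℤ < Γ
    0<Γ = 0<^ K₁ 0<γ

    0≤C : 0ℤ ≤ C
    0≤C = (0≤+ {3} ⊛ (0≤square κ ⊛ 0≤square κ)) ⊛ 0≤D

    0<threshold : 0ℤ < D + + 2 * κ * κ
    0<threshold = +-mono-<-≤ 0<D (0≤+ {2} ⊛ 0≤κ ⊛ 0≤κ)

    0<ν : 0ℤ < ν
    0<ν = <-≤-trans (0<* 0<γ 0<threshold) large

    record State : Set where
      field
        x      : Fin N → Bool
        y      : Fin n → Bool
        q P    : ℤ
        alive  : ∀ e v → x e ≡ true → I e v ≡ true → y v ≡ true
        0<q    : 0ℤ < q
        0<P    : 0ℤ < P
        P≤qD   : P ≤ q * D
        deg≤Δ  : ∀ v → deg x v ≤ Δ

      open Step L x y q P alive public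

      field
        -- As fractions: P / q ≥ D (m / n) ^ `K₁` and V / q² ≤ C n (n / m) ^ `K`. At m ≥ n / g the
        -- powers of n / m are bounded by constants.
        target   : q * D * m ^ K₁ ≤ P * ν ^ K₁
        variance : V * m ^ K ≤ C * (ν ^ K * ν) * (q * q)
        picked   : List (Fin N)
        picked-dead     : All (λ e → ∀ v → I e v ≡ true → y v ≡ false) picked
        picked-disjoint : AllPairs (λ e f → ∀ v → I e v ≡ true → I f v ≡ false) picked
        dead-covered    : ∀ v → y v ≡ false → Any (λ e → I e v ≡ true) picked

    module Continue (s : State) (unfinished : ν ≤ State.m s * γ) where

      open State s

      threshold≤m : D + + 2 * κ * κ ≤ m
      threshold≤m = *-cancelˡ-≤-positive 0<γ (≤-trans large (≤-trans unfinished (≤-reflexive (*-comm m γ))))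

      D≤m : D ≤ m
      D≤m = ≤-trans (≤-from-difference _ (0≤+ {2} ⊛ 0≤κ ⊛ 0≤κ) refl) threshold≤m

      2κ²≤m : + 2 * κ * κ ≤ m
      2κ²≤m = ≤-trans (≤-from-difference _ 0≤D (+-comm D _)) threshold≤m

      0<m : 0ℤ < m
      0<m = <-≤-trans 0<D D≤m

      0≤m-κ : 0ℤ ≤ m - κ
      0≤m-κ = ≤-trans
        (0≤difference 2κ²≤m ⊕ 0≤κ ⊛ 0≤difference (+≤+ 1≤k) ⊕ 0≤square κ)
        (≤-reflexive (expand m κ))
        where
        expand : ∀ m κ → m - + 2 * κ * κ + κ * (κ - 1ℤ) + κ * κ ≡ m - κ
        expand = solve-∀

      m≤ν : m ≤ ν
      m≤ν = subst (m ≤_) (∑-one n) (∑-mono λ v → ⟦⟧≤1 (y v))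

      qD≤PΓ : q * D ≤ P * Γ
      qD≤PΓ = *-cancelˡ-≤-positive (0<^ K₁ 0<m) (begin
        m ^ K₁ * (q * D)        ≡⟨ *-comm (m ^ K₁) _ ⟩
        q * D * m ^ K₁          ≤⟨ target ⟩
        P * ν ^ K₁              ≤⟨ *-monoˡ-≤-nonNeg P {{nonNegative (<⇒≤ 0<P)}} (^-monoˡ K₁ (<⇒≤ 0<ν) unfinished) ⟩
        P * (m * γ) ^ K₁        ≡⟨ cong (P *_) (^-distribʳ-* m γ K₁) ⟩
        P * (m ^ K₁ * Γ)        ≡⟨ swap P (m ^ K₁) Γ ⟩
        m ^ K₁ * (P * Γ)        ∎)
        where
        open ≤-Reasoning
        swap : ∀ a b c → a * (b * c) ≡ b * (a * c)
        swap = solve-∀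

      V≤ : V ≤ C * (γ ^ K * γ) * (q * q) * m
      V≤ = *-cancelˡ-≤-positive (0<^ K 0<m) (begin
        m ^ K * V                                   ≡⟨ *-comm (m ^ K) V ⟩
        V * m ^ K                                   ≤⟨ variance ⟩
        C * (ν ^ K * ν) * (q * q)                   ≤⟨ *-monoʳ-≤-nonNeg (q * q) {{nonNegative (0≤square q)}}
                                                         (*-monoˡ-≤-nonNeg C {{nonNegative 0≤C}}
                                                           (*-mono-≤-nonNeg (0≤^ K (<⇒≤ 0<ν)) (^-monoˡ K (<⇒≤ 0<ν) unfinished) (<⇒≤ 0<ν) unfinished)) ⟩
        C * ((m * γ) ^ K * (m * γ)) * (q * q)       ≡⟨ cong (λ a → C * (a * (m * γ)) * (q * q)) (^-distribʳ-* m γ K) ⟩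
        C * (m ^ K * γ ^ K * (m * γ)) * (q * q)     ≡⟨ regroup C (m ^ K) (γ ^ K) m γ (q * q) ⟩
        m ^ K * (C * (γ ^ K * γ) * (q * q) * m)     ∎)
        where
        open ≤-Reasoning
        regroup : ∀ C M G m γ q → C * (M * G * (m * γ)) * q ≡ M * (C * (G * γ) * q * m)
        regroup = solve-∀

      -- This fixes the value of `D`: the bound on V has one factor D, the lower bound D / Γ on the
      -- target contributes D² after squaring, and the spare D is defined to equal the remaining
      -- constant 4 c g ^ (`K` + 1) Γ².
      V-small : + 4 * V ≤ P * P * m
      V-small = *-cancelˡ-≤-positive (0<* 0<Γ 0<Γ) (begin
        Γ * Γ * (+ 4 * V)
          ≤⟨ *-monoˡ-≤-nonNeg (Γ * Γ) {{nonNegative (0≤square Γ)}} (*-monoˡ-≤-nonNeg (+ 4) V≤) ⟩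
        Γ * Γ * (+ 4 * (c * D * (γ ^ K * γ) * (q * q) * m))
          ≡⟨ regroup Γ c D (γ ^ K * γ) q m ⟩
        q * (+ 4 * c * (γ ^ K * γ) * (Γ * Γ)) * (q * D) * m
          ≡⟨ cong (λ d → q * d * (q * D) * m) (sym D≡) ⟩
        q * D * (q * D) * m
          ≤⟨ *-monoʳ-≤-nonNeg m {{nonNegative 0≤m}} (*-mono-≤-nonNeg 0≤qD qD≤PΓ 0≤qD qD≤PΓ) ⟩
        P * Γ * (P * Γ) * m
          ≡⟨ regroup′ P Γ m ⟩
        Γ * Γ * (P * P * m) ∎)
        where
        open ≤-Reasoning
        0≤qD : 0ℤ ≤ q * D
        0≤qD = <⇒≤ 0<q ⊛ 0≤D
        regroup : ∀ Γ c D G q m → Γ * Γ * (+ 4 * (c * D * G * (q * q) * m)) ≡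
          q * (+ 4 * c * G * (Γ * Γ)) * (q * D) * m
        regroup = solve-∀
        regroup′ : ∀ P Γ m → P * Γ * (P * Γ) * m ≡ Γ * Γ * (P * P * m)
        regroup′ = solve-∀

      edges-remain : P * m ≤ + 2 * (κ * (q * E))
      edges-remain = Pm≤2kqE 0<m 0<P V-small

      0<E : 0ℤ < E
      0<E = *-cancelˡ-<-nonNeg (+ 2 * (κ * q)) {{nonNegative (0≤+ {2} ⊛ (0≤κ ⊛ <⇒≤ 0<q))}}
        (subst₂ _<_ (sym (*-zeroʳ (+ 2 * (κ * q)))) (regroup κ q E) (<-≤-trans (0<* 0<P 0<m) edges-remain))
        where
        regroup : ∀ k q E → + 2 * (k * (q * E)) ≡ + 2 * (k * q) * E
        regroup = solve-∀

      module Extend (e : Fin N) (xe : x e ≡ true)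
        (EG≤ : E * G e ≤ E * (m * m * V) + + 2 * m * (m * Δ * V)
          + E * (R * R * m + q * q * (m * m) * (κ * (κ * κ * Δ)))) where

        open Removal L x y q P alive e xe

        B : ℤ
        B = + 8 * κ * κ * Γ

        0≤B : 0ℤ ≤ B
        0≤B = 0≤+ {8} ⊛ 0≤κ ⊛ 0≤κ ⊛ <⇒≤ 0<Γ

        m-κ<m : m - κ + 1ℤ ≤ m
        m-κ<m = ≤-from-difference _ (0≤difference (+≤+ 1≤k)) (expand m κ)
          where
          expand : ∀ m κ → m ≡ m - κ + 1ℤ + (κ - 1ℤ)
          expand = solve-∀

        0<left : 0ℤ < m - κ * (κ - 1ℤ)
        0<left = <-≤-trans (+-mono-≤-< {0ℤ} (0≤difference 2κ²≤m ⊕ 0≤square κ) (+<+ 1≤k)) (≤-reflexive (expand m κ))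
          where
          expand : ∀ m κ → m - + 2 * κ * κ + κ * κ + κ ≡ m - κ * (κ - 1ℤ)
          expand = solve-∀

        P′≤q′D : P′ ≤ q′ * D
        P′≤q′D = ≤-from-difference _
          (<⇒≤ 0<P ⊛ (0≤κ ⊛ 0≤difference (+≤+ 1≤k)) ⊕ 0≤m ⊛ 0≤difference P≤qD)
          (expand q m D P κ)
          where
          expand : ∀ q m D P κ → q * m * D ≡ P * (m - κ * (κ - 1ℤ)) + (P * (κ * (κ - 1ℤ)) + m * (q * D - P))
          expand = solve-∀

        target′ : q′ * D * (m - κ) ^ K₁ ≤ P′ * ν ^ K₁
        target′ = target-decay {κ} {m} {q} {D} {P} {m ^ K₁} {(m - κ) ^ K₁} {ν ^ K₁}
          0≤κ (+≤+ 1≤k) 0<m (0≤^ K₁ 0≤m) (0≤^ K₁ 0≤m-κ) (<⇒≤ 0<q) 0≤D 2κ²≤m target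
          (subst (λ a → (m + a) * (m - κ) ^ K₁ ≤ m ^ K₁ * m) K₁≡ (bernoulli K₁ 0≤m-κ m-κ<m))

        one-step-bound : G e ≤ m * m * V + B * m * V + C * (q * q * (m * m))
        one-step-bound = one-step {κ} {Γ} {D} {P} {q} {m} {E} {V} {G e}
          0≤κ (+≤+ 1≤k) (<⇒≤ 0<Γ) 0≤D 0<P 0<q 0<E 0≤V D≤m P≤qD qD≤PΓ edges-remain EG≤

        variance′ : Next.V * (m - κ) ^ K ≤ C * (ν ^ K * ν) * (q′ * q′)
        variance′ = variance-decay {m} {V} {Next.V} {B} {C} {m ^ K} {(m - κ) ^ K} {ν ^ K * ν} {q}
          0<m (0<^ K 0<m) (0≤^ K 0≤m-κ) 0≤B 0≤C (≤-trans variance′≤ one-step-bound) variance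
          (*-mono-≤-nonNeg (0≤^ K 0≤m) (^-monoˡ K 0≤m m≤ν) 0≤m m≤ν)
          (subst (λ a → (m + a) * (m - κ) ^ K ≤ m ^ K * m) K≡ (bernoulli K 0≤m-κ m-κ<m))

        e-dead : ∀ v → I e v ≡ true → y′ v ≡ false
        e-dead v ev = trans (cong (λ b → y v ∧ not b) ev) (∧-zeroʳ (y v))

        e-disjoint : ∀ {f} → (∀ v → I f v ≡ true → y v ≡ false) → ∀ v → I e v ≡ true → I f v ≡ false
        e-disjoint {f} dead v ev with I f v in fv
        ... | false = refl
        ... | true with () ← trans (sym (alive e v xe ev)) (dead v fv)

        dead-covered′ : ∀ v → y′ v ≡ false → Any (λ f → I f v ≡ true) (e ∷ picked)
        dead-covered′ v y′v with I e v in ev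
        ... | true  = here ev
        ... | false = there (dead-covered v (trans (sym (∧-identityʳ (y v))) y′v))

        state′ : State
        state′ = record
          { x = x′ ; y = y′ ; q = q′ ; P = P′
          ; alive = alive′
          ; 0<q = 0<* 0<q 0<m
          ; 0<P = 0<* 0<P 0<left
          ; P≤qD = P′≤q′D
          ; deg≤Δ = λ v → ≤-trans (deg′≤deg v) (deg≤Δ v)
          ; target = subst (λ s → q′ * D * s ^ K₁ ≤ P′ * ν ^ K₁) (sym ∑-Y′) target′
          ; variance = subst (λ s → Next.V * s ^ K ≤ C * (ν ^ K * ν) * (q′ * q′)) (sym ∑-Y′) variance′
          ; picked = e ∷ picked
          ; picked-dead = e-dead ∷ All.map (λ dead v fv → cong (λ b → b ∧ not (I e v)) (dead v fv)) picked-dead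
          ; picked-disjoint = All.map e-disjoint picked-dead ∷ picked-disjoint
          ; dead-covered = dead-covered′
          }

      next : Σ[ s′ ∈ State ] State.m s′ ≡ m - κ
      next = let e , xe , EG≤ = average x G _ 0<E (∑-G 1≤k 0<q (<⇒≤ 0<P) 0<m Δ deg≤Δ) in
        Extend.state′ e xe EG≤ , Removal.∑-Y′ L x y q P alive e xe

    -- `t` is fuel bounding the number of alive vertices, of which each step removes k ≥ 1. At t = 0
    -- no unfinished state is left, since unfinished states have m > 0.
    run : ∀ t (s : State) → State.m s ≤ + t → Σ[ s′ ∈ State ] State.m s′ * γ < ν
    run t s m≤t with ν ≤? State.m s * γ
    run t       s m≤t | no  ≰ = s , ≰⇒> ≰
    run zero    s m≤t | yes unfinished = ⊥-elim (<-irrefl refl (<-≤-trans (Continue.0<m s unfinished) m≤t))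
    run (suc t) s m≤t | yes unfinished =
      let s′ , m′≡ = Continue.next s unfinished in
      run t s′ (≤-trans (≤-reflexive m′≡) (≤-from-difference _
        (0≤difference m≤t ⊕ 0≤difference (+≤+ 1≤k)) (expand (+ t) (State.m s) κ)))
      where
      expand : ∀ t m κ → t ≡ m - κ + (1ℤ + t - m + (κ - 1ℤ))
      expand = solve-∀

    initial : (x : Fin N → Bool) → (∀ v → deg x v ≤ Δ) →
      ∑ (λ v → (D - deg x v) * (D - deg x v)) ≤ D * ν → State
    initial x deg≤Δ variance₀ = record
      { x = x ; y = λ _ → true ; q = 1ℤ ; P = D
      ; alive = λ _ _ _ _ → refl
      ; 0<q = +<+ (ℕ.s≤s ℕ.z≤n)
      ; 0<P = 0<D
      ; P≤qD = ≤-reflexive (sym (*-identityˡ D))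
      ; deg≤Δ = deg≤Δ
      ; target = ≤-reflexive (cong₂ (λ a b → a * b ^ K₁) (*-identityˡ D) (∑-one n))
      -- With q = 1 and all vertices alive, V is the irregularity of the starting system; the factor
      -- c ≥ 1 in C leaves room.
      ; variance = begin
          S.V * S.m ^ K               ≡⟨ cong₂ (λ a b → a * b ^ K) (∑-cong λ v → flip (deg x v) D) (∑-one n) ⟩
          ∑ (λ v → (D - deg x v) * (D - deg x v)) * ν ^ K
            ≤⟨ *-monoʳ-≤-nonNeg (ν ^ K) {{nonNegative (0≤^ K (<⇒≤ 0<ν))}} variance₀ ⟩
          D * ν * ν ^ K               ≤⟨ ≤-from-difference _
                                           (0≤D ⊛ (0≤^ K (<⇒≤ 0<ν) ⊛ <⇒≤ 0<ν) ⊛ 0≤difference 1≤c)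
                                           (expand c D (ν ^ K) ν) ⟩
          C * (ν ^ K * ν) * (1ℤ * 1ℤ) ∎
      ; picked = []
      ; picked-dead = []
      ; picked-disjoint = []
      ; dead-covered = λ _ ()
      }
      where
      open ≤-Reasoning
      module S = Step L x (λ _ → true) 1ℤ D (λ _ _ _ _ → refl)
      flip : ∀ d D → (1ℤ * d - D * 1ℤ) * (1ℤ * d - D * 1ℤ) ≡ (D - d) * (D - d)
      flip = solve-∀
      expand : ∀ c D M ν → c * D * (M * ν) * (1ℤ * 1ℤ) ≡ D * ν * M + D * (M * ν) * (c - 1ℤ)
      expand = solve-∀
      1≤κ² : 1ℤ ≤ κ * κ
      1≤κ² = *-mono-≤-nonNeg {1ℤ} {κ} {1ℤ} {κ} (0≤+ {1}) (+≤+ 1≤k) (0≤+ {1}) (+≤+ 1≤k)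
      1≤κ⁴ : 1ℤ ≤ κ * κ * (κ * κ)
      1≤κ⁴ = *-mono-≤-nonNeg {1ℤ} {κ * κ} {1ℤ} {κ * κ} (0≤+ {1}) 1≤κ² (0≤+ {1}) 1≤κ²
      1≤c : 1ℤ ≤ c
      1≤c = *-mono-≤-nonNeg {1ℤ} {+ 3} {1ℤ} {κ * κ * (κ * κ)} (0≤+ {1}) (+≤+ (ℕ.s≤s ℕ.z≤n)) (0≤+ {1}) 1≤κ⁴

-- Translation between subsets and indicator sums.

module SubsetCounting where

  open import Data.Bool.Base using (Bool; true; false; _∧_; not)
  open import Data.Fin.Base using (Fin; zero; suc)
  import Data.Fin.Properties as Finₚ
  open import Data.Fin.Subset using (Subset; ∣_∣; _∩_; ⋃; Empty)
  open import Data.Fin.Subset.Properties using (_∈?_; p⊆p∪q; q⊆p∪q; x∈p∩q⁻; Empty-unique; ∣⊥∣≡0)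
  open import Data.Integer.Base hiding (suc; ∣_∣)
  open import Data.Integer.Properties hiding (_≟_)
  open import Data.List.Base as List using (List; []; _∷_; length; filter)
  open import Data.List.Membership.Propositional.Properties using (∈-lookup)
  open import Data.List.Relation.Unary.All as All using ([]; _∷_)
  open import Data.List.Relation.Unary.AllPairs using ([]; _∷_)
  open import Data.List.Relation.Unary.Any using (Any; here; there)
  open import Data.List.Relation.Unary.Unique.Propositional using (Unique)
  open import Data.Nat.Base as ℕ using (ℕ; zero; suc)
  open import Data.Product.Base using (_,_)
  open import Data.Vec.Base as Vec using ([]; _∷_)
  open import Data.Vec.Properties using ([]=⇒lookup; lookup⇒[]=)
  open import Data.Empty using (⊥-elim)
  open import Relation.Binary.PropositionalEquality hiding (J)
  open import Relation.Nullary.Decidable using (yes; no; does)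
  open IntegerSums

  ∑-lookup : ∀ {n} (s : Subset n) → ∑ (λ v → ⟦ Vec.lookup s v ⟧) ≡ + ∣ s ∣
  ∑-lookup []          = ∑-empty _
  ∑-lookup (true  ∷ s) = trans (∑-step _) (cong (_+_ 1ℤ) (∑-lookup s))
  ∑-lookup (false ∷ s) = trans (∑-step _) (trans (+-identityˡ _) (∑-lookup s))

  two≤∑ : ∀ {n} (b : Fin n → Bool) {u v} → b u ≡ true → b v ≡ true → u ≢ v → + 2 ≤ ∑ (λ i → ⟦ b i ⟧)
  two≤∑ {n} b {u} {v} bu bv u≢v = begin
    1ℤ + 1ℤ                          ≤⟨ +-monoˡ-≤ 1ℤ (subst (_≤ ∑ f) fu≡1 (term≤∑ u λ i → 0≤⟦⟧ _)) ⟩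
    ∑ f + 1ℤ                         ≡⟨ cong (λ c → ∑ f + ⟦ c ⟧) (sym bv) ⟩
    ∑ f + ⟦ b v ⟧                    ≤⟨ ∑-mono-except {f = f} {g = λ i → ⟦ b i ⟧} v (λ i _ → ⟦∧⟧≤ (b i) _) ⟩
    ∑ (λ i → ⟦ b i ⟧) + f v          ≡⟨ cong (_+_ (∑ (λ i → ⟦ b i ⟧))) fv≡0 ⟩
    ∑ (λ i → ⟦ b i ⟧) + 0ℤ           ≡⟨ +-identityʳ _ ⟩
    ∑ (λ i → ⟦ b i ⟧)                ∎
    where
    open ≤-Reasoning
    f : Fin n → ℤ
    f i = ⟦ b i ∧ not (does (i Finₚ.≟ v)) ⟧
    ⟦∧⟧≤ : ∀ a c → ⟦ a ∧ c ⟧ ≤ ⟦ a ⟧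
    ⟦∧⟧≤ false c = ≤-refl
    ⟦∧⟧≤ true  c = ⟦⟧≤1 c
    fu≡1 : f u ≡ 1ℤ
    fu≡1 with u Finₚ.≟ v
    ... | yes u≡v = ⊥-elim (u≢v u≡v)
    ... | no _    = cong (λ c → ⟦ c ∧ true ⟧) bu
    fv≡0 : f v ≡ 0ℤ
    fv≡0 with v Finₚ.≟ v
    ... | yes _  = cong (λ c → ⟦ c ∧ false ⟧) bv
    ... | no v≢v = ⊥-elim (v≢v refl)

  ∑-edges : ∀ {n} (es : List (Subset n)) v →
    ∑ (λ e → ⟦ Vec.lookup (List.lookup es e) v ⟧) ≡ + length (filter (v ∈?_) es)
  ∑-edges []       v = ∑-empty _
  ∑-edges (s ∷ es) v = trans (∑-step _) (by-membership (Vec.lookup s v) refl)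
    where
    by-membership : ∀ b → Vec.lookup s v ≡ b →
      ⟦ Vec.lookup s v ⟧ + ∑ (λ e → ⟦ Vec.lookup (List.lookup es e) v ⟧) ≡ + length (filter (v ∈?_) (s ∷ es))
    by-membership b sv with v ∈? s
    ... | yes v∈s = cong₂ (λ c t → ⟦ c ⟧ + t) ([]=⇒lookup v∈s) (∑-edges es v)
    by-membership true  sv | no v∉s = ⊥-elim (v∉s (lookup⇒[]= v s sv))
    by-membership false sv | no v∉s = trans (cong₂ (λ c t → ⟦ c ⟧ + t) sv (∑-edges es v)) (+-identityˡ _)

  lookup-injective : ∀ {A : Set} {xs : List A} → Unique xs →
    ∀ i j → List.lookup xs i ≡ List.lookup xs j → i ≡ j
  lookup-injective (x∉ ∷ xs!) zero    zero    eq = refl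
  lookup-injective (x∉ ∷ xs!) zero    (suc j) eq = ⊥-elim (All.lookup x∉ (∈-lookup j) eq)
  lookup-injective (x∉ ∷ xs!) (suc i) zero    eq = ⊥-elim (All.lookup x∉ (∈-lookup i) (sym eq))
  lookup-injective (x∉ ∷ xs!) (suc i) (suc j) eq = cong suc (lookup-injective xs! i j eq)

  lookup-⋃ : ∀ {n} {ss : List (Subset n)} v → Any (λ s → Vec.lookup s v ≡ true) ss → Vec.lookup (⋃ ss) v ≡ true
  lookup-⋃ {ss = s ∷ ss} v (here sv)   = []=⇒lookup (p⊆p∪q (⋃ ss) (lookup⇒[]= v s sv))
  lookup-⋃ {ss = s ∷ ss} v (there any) = []=⇒lookup (q⊆p∪q s (⋃ ss) (lookup⇒[]= v (⋃ ss) (lookup-⋃ v any)))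

  disjoint⇒Empty : ∀ {n} {s t : Subset n} →
    (∀ v → Vec.lookup s v ≡ true → Vec.lookup t v ≡ false) → Empty (s ∩ t)
  disjoint⇒Empty {s = s} {t} disjoint (v , v∈s∩t) with x∈p∩q⁻ s t v∈s∩t
  ... | v∈s , v∈t with () ← trans (sym ([]=⇒lookup v∈t)) (disjoint v ([]=⇒lookup v∈s))

  -- A set disjoint from itself is empty, so nonemptiness has to be assumed; for edges it comes from
  -- k ≥ 1.
  disjoint⇒≢ : ∀ {n} {s t : Subset n} → 1 ℕ.≤ ∣ s ∣ →
    (∀ v → Vec.lookup s v ≡ true → Vec.lookup t v ≡ false) → s ≢ t
  disjoint⇒≢ {n} {s} 1≤∣s∣ disjoint refl with subst (λ p → 1 ℕ.≤ ∣ p ∣) (Empty-unique s-empty) 1≤∣s∣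
    where
    s-empty : Empty s
    s-empty (v , v∈s) with () ← trans (sym ([]=⇒lookup v∈s)) (disjoint v ([]=⇒lookup v∈s))
  ... | 1≤∣⊥∣ with () ← subst (1 ℕ.≤_) (∣⊥∣≡0 n) 1≤∣⊥∣

-- Choice of constants and the matching in a dense linear hypergraph.

module NearPerfectMatching where

  open import Data.Bool.Base using (true; false; _∧_)
  open import Data.Fin.Base using (Fin)
  import Data.Fin.Properties as Finₚ
  open import Data.Fin.Subset using (∣_∣; _∩_; Subset)
  open import Data.Integer.Base hiding (∣_∣)
  import Data.Integer.Base as ℤ
  open import Data.Integer.Properties
  open import Data.List.Base as List using (List; length; map)
  open import Data.List.Membership.Propositional using (_∈_)
  open import Data.List.Membership.Propositional.Properties using (∈-lookup; ∈-map⁻)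
  open import Data.List.Relation.Unary.All as All using (All)
  open import Data.List.Relation.Unary.AllPairs as AllPairs using (AllPairs)
  import Data.List.Relation.Unary.AllPairs.Properties as AllPairsₚ
  import Data.List.Relation.Unary.Any.Properties as Anyₚ
  open import Data.Nat.Base as ℕ using (ℕ)
  import Data.Nat.Properties as ℕₚ
  open import Data.Product.Base using (_×_; _,_; ∃-syntax; Σ-syntax; proj₁; proj₂)
  open import Data.Vec.Base as Vec using ()
  open import Data.Vec.Properties using (lookup-zipWith)
  open import Relation.Binary.PropositionalEquality hiding (J)
  open import Relation.Nullary.Decidable using (decidable-stable)
  open import Defs
  open IntegerSums
  open LinearSystems
  open Estimates
  open NearRegularSubgraph
  open GreedyMatching
  open SubsetCounting

  linearSystem : ∀ {n k} (H : Hypergraph n) → Uniform k H → Linear H →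
    LinearSystem (length (edges H)) n k
  linearSystem {n} {k} H unif lin = record
    { I = λ e → Vec.lookup (edge e)
    ; uniform = λ e → trans (∑-lookup (edge e)) (cong +_ (All.lookup unif (∈-lookup e)))
    ; linear = λ {e} {f} {u} {v} eu ev fu fv u≢v → decidable-stable (e Finₚ.≟ f) λ e≢f →
        ℕₚ.<⇒≱ (two≤meet {e} {f} eu ev fu fv u≢v)
          (lin (∈-lookup e) (∈-lookup f) (λ eq → e≢f (lookup-injective (edges-unique H) e f eq)))
    }
    where
    edge : Fin (length (edges H)) → Subset n
    edge = List.lookup (edges H)
    two≤meet : ∀ {e f u v} → Vec.lookup (edge e) u ≡ true → Vec.lookup (edge e) v ≡ true →
      Vec.lookup (edge f) u ≡ true → Vec.lookup (edge f) v ≡ true → u ≢ v → 2 ℕ.≤ ∣ edge e ∩ edge f ∣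
    two≤meet {e} {f} {u} {v} eu ev fu fv u≢v = drop‿+≤+ (subst (+ 2 ≤_) (∑-lookup (edge e ∩ edge f))
      (two≤∑ (Vec.lookup (edge e ∩ edge f))
        (trans (lookup-zipWith _∧_ u (edge e) (edge f)) (cong₂ _∧_ eu fu))
        (trans (lookup-zipWith _∧_ v (edge e) (edge f)) (cong₂ _∧_ ev fv)) u≢v))

  -- `K₁` is the exponent from `target-decay`. In `K` the summand 8 k² g ^ `K₁` pays for the
  -- relative growth of the variance and 1 for the additive noise. `D` comes from `V-small`, and `C`
  -- equals `D` because of `ν≤κb̂`. Finally `n₀` guarantees m ≥ D + 2 k² as long as m g ≥ n, which
  -- both estimates of a step require.
  record Constants (k g : ℕ) : Set where
    field
      K₁ K C n₀ : ℕ
      D         : ℤ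
      K₁≡ : + K₁ ≡ + 2 * + k * + k
      K≡  : + K ≡ 1ℤ + + 8 * + k * + k * (+ g) ^ K₁
      D≡  : D ≡ + 4 * (+ 3 * (+ k * + k * (+ k * + k))) * ((+ g) ^ K * + g) * ((+ g) ^ K₁ * (+ g) ^ K₁)
      C≡  : + C ≡ D
      n₀≡ : + n₀ ≡ + g * (D + + 2 * + k * + k)
      0<D : 0ℤ < D

    0<C : 0 ℕ.< C
    0<C = drop‿+<+ (subst (0ℤ <_) (sym C≡) 0<D)

  -- Hides the value of the constants, which are too large to be unfolded.
  natural : ∀ {i} → 0ℤ ≤ i → ∃[ n ] + n ≡ i
  natural {i} 0≤i = ℤ.∣ i ∣ , 0≤i⇒+∣i∣≡i 0≤i

  constants : ∀ k g → 1 ℕ.≤ k → 1 ℕ.≤ g → Constants k g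
  constants k g 1≤k 1≤g =
    let K₁ , K₁≡ = natural {+ 2 * + k * + k} (0≤+ {2} ⊛ 0≤+ {k} ⊛ 0≤+ {k})
        K , K≡   = natural {1ℤ + + 8 * + k * + k * (+ g) ^ K₁}
                     (0≤+ {1} ⊕ 0≤+ {8} ⊛ 0≤+ {k} ⊛ 0≤+ {k} ⊛ 0≤^ K₁ (0≤+ {g}))
        0<D      = positive-D (0<^ K (+<+ 1≤g)) (0<^ K₁ (+<+ 1≤g))
        C , C≡   = natural (<⇒≤ 0<D)
        n₀ , n₀≡ = natural (0≤+ {g} ⊛ (<⇒≤ 0<D ⊕ 0≤+ {2} ⊛ 0≤+ {k} ⊛ 0≤+ {k}))
    in record { K₁≡ = K₁≡ ; K≡ = K≡ ; D≡ = refl ; C≡ = C≡ ; n₀≡ = n₀≡ ; 0<D = 0<D }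
    where
    positive-D : ∀ {a b} → 0ℤ < a → 0ℤ < b →
      0ℤ < + 4 * (+ 3 * (+ k * + k * (+ k * + k))) * (a * + g) * (b * b)
    positive-D 0<a 0<b = 0<* (0<* (0<* {+ 4} (+<+ (ℕ.s≤s ℕ.z≤n)) (0<* {+ 3} (+<+ (ℕ.s≤s ℕ.z≤n)) (0<* 0<k² 0<k²)))
      (0<* 0<a (+<+ 1≤g))) (0<* 0<b 0<b)
      where
      0<k² : 0ℤ < + k * + k
      0<k² = 0<* {+ k} {+ k} (+<+ 1≤k) (+<+ 1≤k)

  module Construction (k g : ℕ) (1≤k : 1 ℕ.≤ k) (1≤g : 1 ℕ.≤ g) (constants : Constants k g) where

    open Constants constants

    κ γ : ℤ
    κ = + k
    γ = + g

    module _ {n : ℕ} (0<n : 0 ℕ.< n) (n₀≤n : n₀ ℕ.≤ n) (H : Hypergraph n) (unif : Uniform k H) (lin : Linear H)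
      (dense : ∀ v → n ℕ.+ C ℕ.* k ℕ.≤ degree H v ℕ.* k) where

      L : LinearSystem (length (edges H)) n k
      L = linearSystem H unif lin

      open LinearSystem L

      large : γ * (D + + 2 * κ * κ) ≤ + n
      large = subst (_≤ + n) n₀≡ (+≤+ n₀≤n)

      dense′ : ∀ v → + n + κ * D ≤ κ * ∑ (λ e → J e v)
      dense′ v = begin
        + n + κ * D                ≡⟨ cong (_+_ (+ n)) (trans (*-comm κ D) (cong (_* κ) (sym C≡))) ⟩
        + n + + C * κ              ≡⟨ cong (_+_ (+ n)) (sym (pos-* C k)) ⟩
        + (n ℕ.+ C ℕ.* k)          ≤⟨ +≤+ (dense v) ⟩
        + (degree H v ℕ.* k)       ≡⟨ trans (pos-* (degree H v) k) (*-comm (+ degree H v) κ) ⟩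
        κ * + degree H v           ≡⟨ cong (κ *_) (sym (∑-edges (edges H) v)) ⟩
        κ * ∑ (λ e → J e v)        ∎
        where open ≤-Reasoning

      module Gm = Greedy L g K₁ K D 1≤k 1≤g 0<D K₁≡ K≡ D≡ large

      final : Σ[ s ∈ Gm.State ] Gm.State.m s * γ < + n
      final =
        let x , minimal = least-irregular L D
            module Local = LocalMinimum L 1≤k D (i<j⇒suc[i]≤j 0<D) x minimal dense′
            start = Gm.initial x Local.deg≤2κD (Local.Φ≤Dν 0<n)
        in Gm.run n start (≤-reflexive (∑-one n))

      matching : ∃[ m ] (m ℕ.* g ℕ.≤ n × Σ[ M ∈ Matching H ] n ℕ.≤ ∣ covered M ∣ ℕ.+ m)
      matching = from-state (proj₁ final) (proj₂ final)
        where
        from-state : (s : Gm.State) → Gm.State.m s * γ < + n →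
          ∃[ m ] (m ℕ.* g ℕ.≤ n × Σ[ M ∈ Matching H ] n ℕ.≤ ∣ covered M ∣ ℕ.+ m)
        from-state s mγ<n = ℤ.∣ m ∣ , few , M , drop‿+≤+ enough
          where
          open Gm.State s
          edge : Fin (length (edges H)) → Subset n
          edge = List.lookup (edges H)
          m≡ : + ℤ.∣ m ∣ ≡ m
          m≡ = 0≤i⇒+∣i∣≡i 0≤m
          few : ℤ.∣ m ∣ ℕ.* g ℕ.≤ n
          few = drop‿+≤+ (subst (_≤ + n) (sym (trans (pos-* ℤ.∣ m ∣ g) (cong (_* γ) m≡))) (<⇒≤ mγ<n))
          M : Matching H
          M = record
            { members  = map edge picked
            ; unique   = AllPairsₚ.map⁺ (AllPairs.map
                (λ {e} → disjoint⇒≢ (subst (1 ℕ.≤_) (sym (All.lookup unif (∈-lookup e))) 1≤k)) picked-disjoint)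
            ; included = λ s∈ → let e , _ , s≡ = ∈-map⁻ edge s∈ in subst (_∈ edges H) (sym s≡) (∈-lookup e)
            ; disjoint = AllPairsₚ.map⁺ (AllPairs.map disjoint⇒Empty picked-disjoint)
            }
          -- An alive vertex is counted by `Y`, and a dead one lies in a picked edge by
          -- `dead-covered`; summing over v gives the lower bound on the cover.
          1≤ : ∀ v → 1ℤ ≤ ⟦ Vec.lookup (covered M) v ⟧ + Y v
          1≤ v = by-cases (y v) refl
            where
            by-cases : ∀ b → y v ≡ b → 1ℤ ≤ ⟦ Vec.lookup (covered M) v ⟧ + Y v
            by-cases true  yv = subst (λ b → 1ℤ ≤ ⟦ Vec.lookup (covered M) v ⟧ + ⟦ b ⟧) (sym yv)
              (+-mono-≤ (0≤⟦⟧ (Vec.lookup (covered M) v)) (≤-refl {1ℤ}))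
            by-cases false yv = subst (λ b → 1ℤ ≤ ⟦ b ⟧ + Y v)
              (sym (lookup-⋃ v (Anyₚ.map⁺ (dead-covered v yv)))) (+-mono-≤ (≤-refl {1ℤ}) (0≤⟦⟧ (y v)))
          enough : + n ≤ + (∣ covered M ∣ ℕ.+ ℤ.∣ m ∣)
          enough = begin
            + n                                        ≡⟨ sym (∑-one n) ⟩
            ∑ {n} (λ _ → 1ℤ)                           ≤⟨ ∑-mono 1≤ ⟩
            ∑ (λ v → ⟦ Vec.lookup (covered M) v ⟧ + Y v) ≡⟨ ∑-+ _ Y ⟩
            ∑ (λ v → ⟦ Vec.lookup (covered M) v ⟧) + m ≡⟨ cong₂ _+_ (∑-lookup (covered M)) (sym m≡) ⟩
            + ∣ covered M ∣ + + ℤ.∣ m ∣                ∎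
            where open ≤-Reasoning

-- Clearing denominators between naturals and rationals.

module RationalEstimates where

  open import Data.Integer.Base as ℤ using (+_; +[1+_])
  import Data.Integer.Properties as ℤₚ
  open import Data.Nat.Base as ℕ using (ℕ; suc)
  import Data.Nat.Properties as ℕₚ
  open import Data.Product.Base using (_×_; _,_; ∃-syntax)
  open import Data.Rational.Base
  open import Data.Rational.Properties
  import Data.Rational.Unnormalised.Base as ℚᵘ
  import Data.Rational.Unnormalised.Properties as ℚᵘₚ
  open import Data.Integer.Tactic.RingSolver using (solve-∀)
  open import Relation.Binary.PropositionalEquality
  open import Defs using (ℕ→ℚ)

  toℚᵘ-/ : ∀ i d .{{_ : ℕ.NonZero d}} → toℚᵘ (i / d) ℚᵘ.≃ (i ℚᵘ./ d)
  toℚᵘ-/ i (suc d) = toℚᵘ-fromℚᵘ (ℚᵘ.mkℚᵘ i d)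

  ℕ→ℚ-+ : ∀ a b → ℕ→ℚ (a ℕ.+ b) ≡ ℕ→ℚ a + ℕ→ℚ b
  ℕ→ℚ-+ a b = toℚᵘ-injective (begin
    toℚᵘ (ℕ→ℚ (a ℕ.+ b))           ≈⟨ toℚᵘ-/ (+ (a ℕ.+ b)) 1 ⟩
    + (a ℕ.+ b) ℚᵘ./ 1             ≈⟨ ℚᵘ.*≡* (cross (+ a) (+ b)) ⟩
    (+ a ℚᵘ./ 1) ℚᵘ.+ (+ b ℚᵘ./ 1) ≈⟨ ℚᵘₚ.+-cong (toℚᵘ-/ (+ a) 1) (toℚᵘ-/ (+ b) 1) ⟨
    toℚᵘ (ℕ→ℚ a) ℚᵘ.+ toℚᵘ (ℕ→ℚ b) ≈⟨ toℚᵘ-homo-+ (ℕ→ℚ a) (ℕ→ℚ b) ⟨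
    toℚᵘ (ℕ→ℚ a + ℕ→ℚ b)           ∎)
    where
    open ℚᵘₚ.≃-Reasoning
    cross : ∀ a b → (a ℤ.+ b) ℤ.* (+ 1) ≡ (a ℤ.* + 1 ℤ.+ b ℤ.* + 1) ℤ.* + 1
    cross = solve-∀

  /-*-cancel : ∀ i d .{{_ : ℕ.NonZero d}} → (i / d) * ℕ→ℚ d ≡ i / 1
  /-*-cancel i (suc d) = toℚᵘ-injective (begin
    toℚᵘ ((i / suc d) * ℕ→ℚ (suc d))                ≈⟨ toℚᵘ-homo-* (i / suc d) (ℕ→ℚ (suc d)) ⟩
    toℚᵘ (i / suc d) ℚᵘ.* toℚᵘ (ℕ→ℚ (suc d))        ≈⟨ ℚᵘₚ.*-cong (toℚᵘ-/ i (suc d)) (toℚᵘ-/ (+ suc d) 1) ⟩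
    (i ℚᵘ./ suc d) ℚᵘ.* (+ suc d ℚᵘ./ 1)            ≈⟨ ℚᵘ.*≡* (cross i (+ suc d)) ⟩
    i ℚᵘ./ 1                                        ≈⟨ toℚᵘ-/ i 1 ⟨
    toℚᵘ (i / 1)                                    ∎)
    where
    open ℚᵘₚ.≃-Reasoning
    cross : ∀ i d → i ℤ.* d ℤ.* + 1 ≡ i ℤ.* (d ℤ.* + 1)
    cross = solve-∀

  ℕ→ℚ-* : ∀ a b → ℕ→ℚ (a ℕ.* b) ≡ ℕ→ℚ a * ℕ→ℚ b
  ℕ→ℚ-* a b = toℚᵘ-injective (begin
    toℚᵘ (ℕ→ℚ (a ℕ.* b))           ≈⟨ toℚᵘ-/ (+ (a ℕ.* b)) 1 ⟩
    + (a ℕ.* b) ℚᵘ./ 1             ≈⟨ ℚᵘ.*≡* (cong (ℤ._* + 1) (ℤₚ.pos-* a b)) ⟩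
    (+ a ℚᵘ./ 1) ℚᵘ.* (+ b ℚᵘ./ 1) ≈⟨ ℚᵘₚ.*-cong (toℚᵘ-/ (+ a) 1) (toℚᵘ-/ (+ b) 1) ⟨
    toℚᵘ (ℕ→ℚ a) ℚᵘ.* toℚᵘ (ℕ→ℚ b) ≈⟨ toℚᵘ-homo-* (ℕ→ℚ a) (ℕ→ℚ b) ⟨
    toℚᵘ (ℕ→ℚ a * ℕ→ℚ b)           ∎)
    where open ℚᵘₚ.≃-Reasoning

  ℕ→ℚ-mono : ∀ {a b} → a ℕ.≤ b → ℕ→ℚ a ≤ ℕ→ℚ b
  ℕ→ℚ-mono {a} {b} a≤b = toℚᵘ-cancel-≤
    (ℚᵘₚ.≤-respˡ-≃ (ℚᵘₚ.≃-sym (toℚᵘ-/ (+ a) 1)) (ℚᵘₚ.≤-respʳ-≃ (ℚᵘₚ.≃-sym (toℚᵘ-/ (+ b) 1))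
      (ℚᵘ.*≤* (ℤₚ.*-monoʳ-≤-nonNeg (+ 1) (ℤ.+≤+ a≤b)))))

  ℕ→ℚ-cancel : ∀ {a b} → ℕ→ℚ a ≤ ℕ→ℚ b → a ℕ.≤ b
  ℕ→ℚ-cancel {a} {b} le with ℚᵘₚ.≤-respˡ-≃ (toℚᵘ-/ (+ a) 1) (ℚᵘₚ.≤-respʳ-≃ (toℚᵘ-/ (+ b) 1) (toℚᵘ-mono-≤ le))
  ... | ℚᵘ.*≤* le′ = ℤₚ.drop‿+≤+ (ℤₚ.*-cancelʳ-≤-pos (+ a) (+ b) (+ 1) le′)

  ℕ→ℚ-nonNegative : ∀ {a} → NonNegative (ℕ→ℚ a)
  ℕ→ℚ-nonNegative {a} = normalize-nonNeg a 1

  /+≤⇒ : ∀ n k C d .{{_ : ℕ.NonZero k}} → (+ n / k) + ℕ→ℚ C ≤ ℕ→ℚ d → n ℕ.+ C ℕ.* k ℕ.≤ d ℕ.* k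
  /+≤⇒ n k C d le = ℕ→ℚ-cancel (begin
    ℕ→ℚ (n ℕ.+ C ℕ.* k)               ≡⟨ ℕ→ℚ-+ n (C ℕ.* k) ⟩
    ℕ→ℚ n + ℕ→ℚ (C ℕ.* k)             ≡⟨ cong₂ _+_ (sym (/-*-cancel (+ n) k)) (ℕ→ℚ-* C k) ⟩
    (+ n / k) * ℕ→ℚ k + ℕ→ℚ C * ℕ→ℚ k ≡⟨ sym (*-distribʳ-+ (ℕ→ℚ k) (+ n / k) (ℕ→ℚ C)) ⟩
    ((+ n / k) + ℕ→ℚ C) * ℕ→ℚ k       ≤⟨ *-monoʳ-≤-nonNeg (ℕ→ℚ k) {{ℕ→ℚ-nonNegative {k}}} le ⟩
    ℕ→ℚ d * ℕ→ℚ k                     ≡⟨ sym (ℕ→ℚ-* d k) ⟩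
    ℕ→ℚ (d ℕ.* k)                     ∎)
    where open ≤-Reasoning

  -- The denominator of δ serves as g: g δ is then the numerator of a positive fraction, hence at
  -- least 1.
  1≤ℕ→ℚ*δ : ∀ δ → 0ℚ < δ → ∃[ g ] (1 ℕ.≤ g × 1ℚ ≤ ℕ→ℚ g * δ)
  1≤ℕ→ℚ*δ δ 0<δ = from-positive δ (positive 0<δ)
    where
    open ≤-Reasoning
    from-positive : ∀ δ → Positive δ → ∃[ g ] (1 ℕ.≤ g × 1ℚ ≤ ℕ→ℚ g * δ)
    from-positive δ@(mkℚ +[1+ a ] d-1 _) _ = suc d-1 , ℕ.s≤s ℕ.z≤n , (begin
      ℕ→ℚ 1                             ≤⟨ ℕ→ℚ-mono {1} {suc a} (ℕ.s≤s ℕ.z≤n) ⟩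
      ℕ→ℚ (suc a)                       ≡⟨ sym (/-*-cancel (+ suc a) (suc d-1)) ⟩
      (+ suc a / suc d-1) * ℕ→ℚ (suc d-1) ≡⟨ cong (_* ℕ→ℚ (suc d-1)) (↥p/↧p≡p δ) ⟩
      δ * ℕ→ℚ (suc d-1)                 ≡⟨ *-comm δ (ℕ→ℚ (suc d-1)) ⟩
      ℕ→ℚ (suc d-1) * δ                 ∎)

  -- From g δ ≥ 1 and m g ≤ n follows m ≤ m g δ ≤ δ n, so the uncovered vertices number at most δ n
  -- ≤ e n.
  near-cover : ∀ {δ e} n m c g → δ ≤ e → 0ℚ < δ → 1ℚ ≤ ℕ→ℚ g * δ →
    m ℕ.* g ℕ.≤ n → n ℕ.≤ c ℕ.+ m → (ℕ→ℚ 1 - e) * ℕ→ℚ n ≤ ℕ→ℚ c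
  near-cover {δ} {e} n m c g δ≤e 0<δ 1≤gδ mg≤n n≤c+m = begin
    (1ℚ - e) * ℕ→ℚ n                      ≤⟨ *-monoʳ-≤-nonNeg (ℕ→ℚ n) {{ℕ→ℚ-nonNegative {n}}} (+-monoʳ-≤ 1ℚ (neg-antimono-≤ δ≤e)) ⟩
    (1ℚ - δ) * ℕ→ℚ n                      ≡⟨ trans (*-distribʳ-+ (ℕ→ℚ n) 1ℚ (- δ)) (cong₂ _+_ (*-identityˡ (ℕ→ℚ n)) (sym (neg-distribˡ-* δ (ℕ→ℚ n)))) ⟩
    ℕ→ℚ n - δ * ℕ→ℚ n                     ≤⟨ +-mono-≤ n≤ (neg-antimono-≤ m≤) ⟩
    (ℕ→ℚ c + ℕ→ℚ m) - ℕ→ℚ m               ≡⟨ trans (+-assoc (ℕ→ℚ c) (ℕ→ℚ m) (- ℕ→ℚ m))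
                                               (trans (cong (_+_ (ℕ→ℚ c)) (+-inverseʳ (ℕ→ℚ m))) (+-identityʳ (ℕ→ℚ c))) ⟩
    ℕ→ℚ c                                 ∎
    where
    open ≤-Reasoning
    n≤ : ℕ→ℚ n ≤ ℕ→ℚ c + ℕ→ℚ m
    n≤ = ≤-trans (ℕ→ℚ-mono n≤c+m) (≤-reflexive (ℕ→ℚ-+ c m))
    m≤ : ℕ→ℚ m ≤ δ * ℕ→ℚ n
    m≤ = begin
      ℕ→ℚ m                      ≡⟨ sym (*-identityʳ (ℕ→ℚ m)) ⟩
      ℕ→ℚ m * 1ℚ                 ≤⟨ *-monoˡ-≤-nonNeg (ℕ→ℚ m) {{ℕ→ℚ-nonNegative {m}}} 1≤gδ ⟩
      ℕ→ℚ m * (ℕ→ℚ g * δ)        ≡⟨ sym (*-assoc (ℕ→ℚ m) (ℕ→ℚ g) δ) ⟩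
      ℕ→ℚ m * ℕ→ℚ g * δ          ≡⟨ trans (cong (_* δ) (sym (ℕ→ℚ-* m g))) (*-comm (ℕ→ℚ (m ℕ.* g)) δ) ⟩
      δ * ℕ→ℚ (m ℕ.* g)          ≤⟨ *-monoˡ-≤-nonNeg δ {{pos⇒nonNeg δ {{positive 0<δ}}}} (ℕ→ℚ-mono mg≤n) ⟩
      δ * ℕ→ℚ n                  ∎

-- The statement for real ε.

open import Defs
open import Data.Nat.Base using (ℕ; NonZero; _≤_; _<_)
open import Data.Integer.Base using (+_)
open import Data.Rational.Base as ℚ using ()
open import Data.Product.Base using (_×_; ∃-syntax; Σ-syntax)
open import Data.Fin.Subset using (∣_∣)

open import Data.List.Base using (length; map; allFin)
open import Data.List.Extrema.Nat using (min≤xs)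
open import Data.List.Membership.Propositional.Properties using (∈-map⁺; ∈-allFin)
import Data.List.Relation.Unary.All as All
open import Data.Nat.Base using (suc; s≤s; z≤n; _+_; _*_)
import Data.Nat.Properties as ℕₚ
open import Data.Product.Base using (_,_)
import Data.Rational.Properties as ℚₚ
open import Relation.Binary.PropositionalEquality using (_≡_; subst)
open RationalEstimates
open NearPerfectMatching

minDegree≤degree : ∀ {n} (H : Hypergraph n) v → minDegree H ≤ degree H v
minDegree≤degree {n} H v =
  All.lookup (min≤xs (length (edges H)) (map (degree H) (allFin n))) (∈-map⁺ (degree H) (∈-allFin v))

matching-if-dense : ∀ {k g} .{{_ : NonZero k}} → 1 ≤ k → 1 ≤ g → (cs : Constants k g) → let open Constants cs in
  ∀ {n} → suc n₀ ≤ n → (H : Hypergraph n) → Uniform k H → Linear H →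
  ((+ n) ℚ./ k) ℚ.+ ℕ→ℚ C ℚ.≤ ℕ→ℚ (minDegree H) →
  ∃[ m ] (m * g ≤ n × Σ[ M ∈ Matching H ] n ≤ ∣ covered M ∣ + m)
matching-if-dense {k} {g} 1≤k 1≤g cs {n} n₀<n H unif lin dense =
  Construction.matching k g 1≤k 1≤g cs (ℕₚ.≤-trans (s≤s z≤n) n₀<n) (ℕₚ.<⇒≤ n₀<n) H unif lin
    λ v → /+≤⇒ n k (Constants.C cs) (degree H v)
      (ℚₚ.≤-trans dense (ℕ→ℚ-mono (minDegree≤degree H v)))

theorem1p2 : ∀ (ε : ℝ) → ℕ→ℝ 0 <ℝ ε →
    ∀ (k : ℕ) .{{_ : NonZero k}} → 2 ≤ k →
    ∃[ C ] ∃[ n₀ ] (0 < C × 0 < n₀ ×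
    (∀ (n : ℕ) → n₀ ≤ n →
    ∀ (H : Hypergraph n) → Uniform k H → Linear H →
    ((+ n) ℚ./ k) ℚ.+ ℕ→ℚ C ℚ.≤ ℕ→ℚ (minDegree H) →
    Σ[ M ∈ Matching H ]
    ((ℕ→ℝ 1 -ℝ ε) *ℝ ℕ→ℝ n ≤ℝ ℕ→ℝ ∣ covered M ∣)))
-- The proof of 0 < ε carries a positive rational δ below all late terms of ε. The whole
-- construction uses this δ, and ε returns only in the final comparison.
theorem1p2 ε (δ , 0<δ , i₀ , δ≤ε) k 2≤k =
  let g , 1≤g , 1≤gδ = 1≤ℕ→ℚ*δ δ 0<δ in with-constants g 1≤g 1≤gδ (constants k g 1≤k 1≤g)
  where
  1≤k : 1 ≤ k
  1≤k = ℕₚ.≤-trans (s≤s z≤n) 2≤k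

  0+δ≡δ : ℕ→ℚ 0 ℚ.+ δ ≡ δ
  0+δ≡δ = ℚₚ.+-identityˡ δ

  δ≤εᵢ : ∀ i → i₀ ≤ i → δ ℚ.≤ seq ε i
  δ≤εᵢ i i₀≤i = subst (ℚ._≤ seq ε i) 0+δ≡δ (δ≤ε i i₀≤i)

  nearly-all : ∀ g → ℚ.1ℚ ℚ.≤ ℕ→ℚ g ℚ.* δ → ∀ n m c → m * g ≤ n → n ≤ c + m →
    (ℕ→ℝ 1 -ℝ ε) *ℝ ℕ→ℝ n ≤ℝ ℕ→ℝ c
  nearly-all g 1≤gδ n m c mg≤n n≤c+m η 0<η = i₀ , λ i i₀≤i → ℚₚ.≤-trans
    (near-cover {δ} {seq ε i} n m c g (δ≤εᵢ i i₀≤i) 0<δ 1≤gδ mg≤n n≤c+m)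
    (subst (ℚ._≤ ℕ→ℚ c ℚ.+ η) (ℚₚ.+-identityʳ (ℕ→ℚ c)) (ℚₚ.+-monoʳ-≤ (ℕ→ℚ c) (ℚₚ.<⇒≤ 0<η)))

  with-constants : ∀ g → 1 ≤ g → ℚ.1ℚ ℚ.≤ ℕ→ℚ g ℚ.* δ → Constants k g →
    ∃[ C ] ∃[ n₀ ] (0 < C × 0 < n₀ ×
    (∀ (n : ℕ) → n₀ ≤ n →
    ∀ (H : Hypergraph n) → Uniform k H → Linear H →
    ((+ n) ℚ./ k) ℚ.+ ℕ→ℚ C ℚ.≤ ℕ→ℚ (minDegree H) →
    Σ[ M ∈ Matching H ]
    ((ℕ→ℝ 1 -ℝ ε) *ℝ ℕ→ℝ n ≤ℝ ℕ→ℝ ∣ covered M ∣)))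
  with-constants g 1≤g 1≤gδ cs =
    -- The successor makes the threshold visibly positive and forces n > 0, which is needed to
    -- choose a vertex maximising r.
    Constants.C cs , suc (Constants.n₀ cs) , Constants.0<C cs , s≤s z≤n ,
    λ n n₀<n H unif lin dense →
    let m , mg≤n , M , n≤c+m = matching-if-dense 1≤k 1≤g cs n₀<n H unif lin dense in
    M , nearly-all g 1≤gδ n m ∣ covered M ∣ mg≤n n≤c+m
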